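{- Let $p\ge5$ be a prime with Legendre symbol $\left(\frac{ -9}{p}\right)=-1$, and let $m\ge0$, $\alpha\ge0$, $n\ge0$ be integers. Then for every $i\in\{1,2,\dots,p-1\}$, $$\overline{S}_9^{\,8m+1}\big(12p^{2\alpha+2}n+(12i+5p)p^{2\alpha+1}\big)\equiv0\pmod{16}.$$
   Context: For $|q|<1$ and a positive integer $k$, write $f_k=\prod_{j\ge1}(1-q^{kj})$. For a positive integer $r$, $\overline{S}_9^{\,r}(n)$ (number of $9$-Schur overpartitions of $n$ with $r$-tuples) is defined by $\sum_{n\ge0}\overline{S}_9^{\,r}(n)q^n=\prod_{n\ge1}\frac{(1+q^{2n-1})^r(1-q^{9(2n-1)})^r}{(1+q^{9(2n-1)})^r(1-q^{2n-1})^r}=\frac{f_2^{3r}f_9^{2r}f_{36}^r}{f_1^{2r}f_4^rf_{18}^{3r}}$. -}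

module Defs where

open import Data.Nat as ℕ using (ℕ; zero; suc; _%_; _/_)
open import Data.Integer as ℤ using (ℤ; +_; -_; _-_)
open import Data.Integer.Divisibility using (_∣_)
open import Data.List using (List; foldr; map; upTo)
open import Data.Product using (_×_; ∃)
open import Relation.Nullary using (¬_)
open import Data.Bool using (if_then_else_)

-- Formal power series in q with integer coefficients: n ↦ coefficient of q^n.
Series : Set
Series = ℕ → ℤ

sumℤ : List ℤ → ℤ
sumℤ = foldr ℤ._+_ (+ 0)

one : Series
one zero    = + 1
one (suc _) = + 0

mulS : Series → Series → Series
mulS f g n = sumℤ (map (λ k → f k ℤ.* g (n ℕ.∸ k)) (upTo (suc n)))

powS : ℕ → Series → Series
powS zero    f = one
powS (suc r) f = mulS f (powS r f)

-- For k = suc m: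
-- 1 + q^k
onePlus : ℕ → Series
onePlus m n = if n ℕ.≡ᵇ 0 then + 1 else (if n ℕ.≡ᵇ suc m then + 1 else + 0)

oneMinus : ℕ → Series
oneMinus m n = if n ℕ.≡ᵇ 0 then + 1 else (if n ℕ.≡ᵇ suc m then - + 1 else + 0)

-- 1 / (1 - q^k) = Σ_j q^{kj}
invOneMinus : ℕ → Series
invOneMinus m n = if (n % suc m) ℕ.≡ᵇ 0 then + 1 else + 0

-- 1 / (1 + q^k) = Σ_j (-1)^j q^{kj}
invOnePlus : ℕ → Series
invOnePlus m n =
  if (n % suc m) ℕ.≡ᵇ 0
  then (if ((n / suc m) % 2) ℕ.≡ᵇ 0 then + 1 else - + 1)
  else + 0

-- The factor (1+q^k)(1-q^{9k}) / ((1+q^{9k})(1-q^k)) for the odd number k = 2j+1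
-- (so k = suc (2j) and 9k = suc (18j + 8)).
oddFactor : ℕ → Series
oddFactor j =
  mulS (mulS (onePlus (2 ℕ.* j)) (oneMinus (18 ℕ.* j ℕ.+ 8)))
       (mulS (invOnePlus (18 ℕ.* j ℕ.+ 8)) (invOneMinus (2 ℕ.* j)))

prodTo : ℕ → Series
prodTo zero    = one
prodTo (suc J) = mulS (oddFactor J) (prodTo J)

-- S̄_9^r(N): coefficient of q^N in ∏_{n≥1} F_{2n-1}(q)^r.  Factors with 2n-1 > N
-- are ≡ 1 mod q^{N+1}, so the partial product over 2n-1 ≤ 2N+1 gives the exact coefficient.
S9bar : ℕ → ℕ → ℤ
S9bar r N = powS r (prodTo (suc N)) N

LegendreMinusOne : ℤ → ℕ → Set
LegendreMinusOne a p = ¬ ((+ p) ∣ a) × ¬ (∃ λ (x : ℤ) → (+ p) ∣ (x ℤ.* x - a))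

{-# OPTIONS --safe #-}

-- Let θ(y) = 1 + 2 Σ_{s≥1} (-1)^s y^{s²} and G(y) = ∏_{k odd} (1+y^k)/(1-y^k), so that the
-- series to study is F^{8m+1} with F = G(q)/G(q⁹); as F ≡ 1 (mod 2), F⁸ ≡ 1 (mod 16) and only F
-- matters.  Gauss's product θ(y) = ∏ (1-y^s)/(1+y^s) gives G(y) θ(y) = θ(y²), and
-- G(y) G(-y) = 1 then gives θ(y) θ(-y) = θ(y²)².  Hence
--   F θ(q⁴)² θ(q³⁶)² = θ(-q) θ(q⁹) θ(-q²) θ(-q¹⁸).
-- Multiplying by θ(q⁴)² θ(q³⁶)² once more turns the left-hand side into F times a series in q⁴
-- that is ≡ 1 (mod 8).  Splitting each theta series according to the residue of s modulo 6, every
-- term of the right-hand side whose exponent is ≡ 5 (mod 6) vanishes modulo 16, except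
--   8 Σ ± q^{x² + 4y²},  x odd and x, y prime to 3.
-- The index N in the theorem is ≡ 5 (mod 6) and contains p to an odd power, and since -9 is not
-- a square modulo p, p | x² + y² forces p | x and p | y; so N is not a sum of two squares.
module Submission where

open import Defs
open import Algebra.Bundles using (CommutativeRing)
import Algebra.Properties.Semiring.Exp
open import Algebra.Solver.Ring.AlmostCommutativeRing
  using (_-Raw-AlmostCommutative⟶_; fromCommutativeRing)
open import Data.Bool using (true; false; if_then_else_)
open import Data.Empty using (⊥-elim)
open import Data.Integer as ℤ using (ℤ; +_)
import Data.Integer.Divisibility.Signed as Signed
import Data.Integer.Properties as ℤₚ
import Data.Integer.Solver as ℤSolver
open import Data.List.Properties using (map-applyUpTo)
import Data.Maybe as Maybe
open import Data.Nat as ℕ using (ℕ; zero; suc; z≤n; s≤s; _%_; _/_)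
open import Data.Nat.Coprimality using (Coprime; coprime-Bézout)
open import Data.Nat.Divisibility as ℕ∣ using (divides; ∣m+n∣m⇒∣n; m%n≡0⇒n∣m; >⇒∤; ∣⇒≤)
open import Data.Nat.DivMod
  using (%-distribˡ-+; %-distribˡ-*; m%n<n; [m+kn]%n≡m%n; [m+n]%n≡m%n; m*n%n≡0; m<n⇒m%n≡m; m/n≡1+[m∸n]/n)
open import Data.Nat.GCD using (module Bézout)
open import Data.Nat.Primality using (Prime; prime⇒irreducible; euclidsLemma; prime⇒nonZero)
import Data.Nat.Properties as ℕₚ
open import Data.Nat.Solver using (module +-*-Solver)
open import Data.Product using (_,_; proj₁; proj₂; ∃; ∃₂)
open import Data.Sum using (_⊎_; inj₁; inj₂; [_,_]′)
open import Function using (_∘_; id)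
open import Level using (0ℓ)
open import Relation.Binary.PropositionalEquality as ≡ using (_≡_; _≢_)
open import Relation.Nullary using (¬_; yes; no)
open import Relation.Nullary.Decidable using (dec⇒maybe)

-- Before the second multiplication nothing survives at exponents ≡ 5 (mod 6): in θ(-q) θ(q⁹) the
-- terms with exponent (3s)², s odd, occur with opposite signs and cancel, so its odd exponents are
-- all ≡ 1 (mod 3), while θ(-q²) θ(-q¹⁸) only has even exponents ≡ 0, 2 (mod 3). The obstacle is the
-- multiplier θ(q⁴)² θ(q³⁶)² of F, which is ≡ 1 only modulo 4 and contains exponents 4s² ≡ 1 (mod
-- 3). Squaring it gives 1 + 8z modulo 16, and 8zF ≡ 8z because F ≡ 1 (mod 2), so F is isolated
-- without inverting a series, and 8z is invisible at odd exponents. The price is the factor 4 Σ ±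
-- q^{4y²} brought in by the second θ(q⁴)²: multiplied by 2 Σ q^{x²} it produces the exceptional sum
-- with coefficient 8.

private
  module ℕSolver = +-*-Solver

  module Arithmetic where
    open ℕSolver

    nine-squares : ∀ s → 9 ℕ.* (s ℕ.* s) ≡ 3 ℕ.* s ℕ.* (3 ℕ.* s)
    nine-squares = solve 1 (λ s → con 9 :* (s :* s) := con 3 :* s :* (con 3 :* s)) ≡.refl

    triple-odd : ∀ t → 3 ℕ.+ t ℕ.* 6 ≡ 3 ℕ.* (1 ℕ.+ t ℕ.* 2)
    triple-odd = solve 1 (λ t → con 3 :+ t :* con 6 := con 3 :* (con 1 :+ t :* con 2)) ≡.refl

    triple-even : ∀ t → 6 ℕ.+ t ℕ.* 6 ≡ 3 ℕ.* (2 ℕ.+ t ℕ.* 2)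
    triple-even = solve 1 (λ t → con 6 :+ t :* con 6 := con 3 :* (con 2 :+ t :* con 2)) ≡.refl

    nine-odd : ∀ j → suc (18 ℕ.* j ℕ.+ 8) ≡ 9 ℕ.* suc (j ℕ.* 2)
    nine-odd = solve 1 (λ j → con 1 :+ (con 18 :* j :+ con 8) := con 9 :* (con 1 :+ j :* con 2)) ≡.refl

    quadruple-square : ∀ s → s ℕ.* s ℕ.* 4 ≡ s ℕ.* 2 ℕ.* (s ℕ.* 2)
    quadruple-square = solve 1 (λ s → s :* s :* con 4 := s :* con 2 :* (s :* con 2)) ≡.refl

-- Theta functions in a ring with nilpotent q

module Theta (R : CommutativeRing 0ℓ 0ℓ)
             (morphism : ℤ.+-*-rawRing -Raw-AlmostCommutative⟶ fromCommutativeRing R) where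

  open CommutativeRing R
  open import Algebra.Properties.Semiring.Exp semiring
  open import Algebra.Properties.Ring ring using (-‿involutive)
  open import Relation.Binary.Reasoning.Setoid setoid
  open _-Raw-AlmostCommutative⟶_ morphism using (⟦_⟧; 0-homo; 1-homo)
  open import Algebra.Solver.Ring ℤ.+-*-rawRing (fromCommutativeRing R) morphism
    (λ a b → Maybe.map (reflexive ∘ ≡.cong ⟦_⟧) (dec⇒maybe (a ℤ.≟ b)))
    using (solve; _:=_; _:+_; _:*_; _:-_; :-_; con; _:^_)

  -- Constants are images of integers, not built from `1#`, because this is how the solver's `con`
  -- evaluates.
  𝟙 𝟚 : Carrier
  𝟙 = ⟦ + 1 ⟧
  𝟚 = ⟦ + 2 ⟧

  *-cancel-𝟙 : ∀ {x y} → y ≈ 𝟙 → x * y ≈ x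
  *-cancel-𝟙 {x} e = trans (*-congˡ (trans e 1-homo)) (*-identityʳ x)

  zeroᵐ : ∀ {x y} → x ≈ 0# → y * x ≈ 0#
  zeroᵐ {x} {y} e = trans (*-congˡ e) (zeroʳ y)

  inverse-unique : ∀ {x y z} → x * y ≈ 𝟙 → x * z ≈ 𝟙 → y ≈ z
  inverse-unique {x} {y} {z} p q = begin
    y           ≈⟨ *-cancel-𝟙 q ⟨
    y * (x * z) ≈⟨ solve 3 (λ x y z → y :* (x :* z) := z :* (x :* y)) refl x y z ⟩
    z * (x * y) ≈⟨ *-cancel-𝟙 p ⟩
    z           ∎

  geometric : ℕ → Carrier → Carrier
  geometric zero    z = 𝟙
  geometric (suc n) z = geometric n z + z ^ suc n

  geometric-sum : ∀ n z → (𝟙 - z) * geometric n z ≈ 𝟙 - z ^ suc n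
  geometric-sum zero z = trans
    (solve 1 (λ z → (con (+ 1) :- z) :* con (+ 1) := con (+ 1) :- z) refl z)
    (+-congˡ (-‿cong (sym (*-identityʳ z))))
  geometric-sum (suc n) z = begin
    (𝟙 - z) * (geometric n z + z ^ suc n)
      ≈⟨ distribˡ _ _ _ ⟩
    (𝟙 - z) * geometric n z + (𝟙 - z) * z ^ suc n
      ≈⟨ +-congʳ (geometric-sum n z) ⟩
    𝟙 - z ^ suc n + (𝟙 - z) * z ^ suc n
      ≈⟨ solve 2 (λ z w → con (+ 1) :- w :+ (con (+ 1) :- z) :* w := con (+ 1) :- z :* w) refl z (z ^ suc n) ⟩
    𝟙 - z ^ suc (suc n) ∎

  sign : ℕ → Carrier
  sign zero    = 𝟙
  sign (suc n) = - sign n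

  neg-^ : ∀ z n → (- z) ^ n ≈ sign n * z ^ n
  neg-^ z zero    = trans (sym (*-cancel-𝟙 refl)) (*-comm _ _)
  neg-^ z (suc n) = trans (*-congˡ (neg-^ z n))
    (solve 3 (λ z c w → :- z :* (c :* w) := :- c :* (z :* w)) refl z (sign n) (z ^ n))

  sign-double : ∀ t → sign (t ℕ.* 2) ≈ 𝟙
  sign-double zero    = refl
  sign-double (suc t) = trans (-‿involutive _) (sign-double t)

  neg-odd : ∀ y t → (- y) ^ suc (t ℕ.* 2) ≈ - (y ^ suc (t ℕ.* 2))
  neg-odd y t = trans (neg-^ y (suc (t ℕ.* 2))) (trans (*-congʳ (-‿cong (sign-double t)))
    (solve 1 (λ z → :- con (+ 1) :* z := :- z) refl _))

  θ : Carrier → ℕ → Carrier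
  θ y zero    = 𝟙
  θ y (suc n) = θ y n + 𝟚 * (sign (suc n) * y ^ (suc n ℕ.* suc n))

  -- z ↦ geometric M z inverts 1 - z on elements with z^(M+1) = 0, so that no
  -- completeness is needed to make sense of 1/(1 ± y^s).
  module _ (M : ℕ) where

    Nilpotent : Carrier → Set
    Nilpotent y = y ^ suc M ≈ 0#

    inv : Carrier → Carrier
    inv = geometric M

    inv-inverse : ∀ {z} → Nilpotent z → (𝟙 - z) * inv z ≈ 𝟙
    inv-inverse {z} nil = begin
      (𝟙 - z) * inv z ≈⟨ geometric-sum M z ⟩
      𝟙 - z ^ suc M   ≈⟨ +-congˡ (-‿cong (trans nil (sym 0-homo))) ⟩
      𝟙 - ⟦ + 0 ⟧     ≈⟨ solve 0 (con (+ 1) :- con (+ 0) := con (+ 1)) refl ⟩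
      𝟙               ∎

    nilpotent-neg : ∀ {z} → Nilpotent z → Nilpotent (- z)
    nilpotent-neg {z} nil = trans (neg-^ z (suc M)) (zeroᵐ nil)

    nilpotent-^ : ∀ {y} → Nilpotent y → ∀ t → Nilpotent (y ^ suc t)
    nilpotent-^ {y} nil t = begin
      (y ^ suc t) ^ suc M       ≈⟨ ^-assocʳ y (suc t) (suc M) ⟩
      y ^ (suc M ℕ.+ t ℕ.* suc M) ≈⟨ ^-homo-* y (suc M) (t ℕ.* suc M) ⟩
      y ^ suc M * y ^ (t ℕ.* suc M) ≈⟨ *-congʳ nil ⟩
      0# * y ^ (t ℕ.* suc M)    ≈⟨ zeroˡ _ ⟩
      0#                        ∎

    nilpotent-≥ : ∀ {y} → Nilpotent y → ∀ {n} → M ℕ.< n → y ^ n ≈ 0#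
    nilpotent-≥ {y} nil {n} M<n = begin
      y ^ n                           ≡⟨ ≡.cong (y ^_) (ℕₚ.m+[n∸m]≡n M<n) ⟨
      y ^ (suc M ℕ.+ (n ℕ.∸ suc M))   ≈⟨ ^-homo-* y (suc M) _ ⟩
      y ^ suc M * y ^ (n ℕ.∸ suc M)   ≈⟨ *-congʳ nil ⟩
      0# * y ^ (n ℕ.∸ suc M)          ≈⟨ zeroˡ _ ⟩
      0#                              ∎

    inv⁺ inv⁻ : Carrier → ℕ → Carrier
    inv⁺ y s = inv (- (y ^ s))
    inv⁻ y s = inv (y ^ s)

    inv⁺-inverse : ∀ {y} → Nilpotent y → ∀ t → (𝟙 + y ^ suc t) * inv⁺ y (suc t) ≈ 𝟙
    inv⁺-inverse {y} nil t = trans (*-congʳ (+-congˡ (sym (-‿involutive _))))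
      (inv-inverse (nilpotent-neg (nilpotent-^ nil t)))

    inv⁻-inverse : ∀ {y} → Nilpotent y → ∀ t → (𝟙 - y ^ suc t) * inv⁻ y (suc t) ≈ 𝟙
    inv⁻-inverse nil t = inv-inverse (nilpotent-^ nil t)

    -- Partial products of Gauss's product and their reciprocals; the latter occur by themselves in
    -- the remainder terms.
    Q Q⁻¹ : Carrier → ℕ → Carrier
    Q y zero      = 𝟙
    Q y (suc n)   = Q y n * ((𝟙 - y ^ suc n) * inv⁺ y (suc n))
    Q⁻¹ y zero    = 𝟙
    Q⁻¹ y (suc n) = Q⁻¹ y n * ((𝟙 + y ^ suc n) * inv⁻ y (suc n))

    Q-inverse : ∀ {y} → Nilpotent y → ∀ n → Q y n * Q⁻¹ y n ≈ 𝟙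
    Q-inverse nil zero = solve 0 (con (+ 1) :* con (+ 1) := con (+ 1)) refl
    Q-inverse {y} nil (suc n) = begin
      Q y n * ((𝟙 - Y) * u) * (Q⁻¹ y n * ((𝟙 + Y) * v))
        ≈⟨ solve 5 (λ q r Y u v → q :* ((con (+ 1) :- Y) :* u) :* (r :* ((con (+ 1) :+ Y) :* v))
             := q :* r :* ((con (+ 1) :+ Y) :* u) :* ((con (+ 1) :- Y) :* v)) refl (Q y n) (Q⁻¹ y n) Y u v ⟩
      Q y n * Q⁻¹ y n * ((𝟙 + Y) * u) * ((𝟙 - Y) * v)
        ≈⟨ *-cancel-𝟙 (inv⁻-inverse nil n) ⟩
      Q y n * Q⁻¹ y n * ((𝟙 + Y) * u)
        ≈⟨ *-cancel-𝟙 (inv⁺-inverse nil n) ⟩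
      Q y n * Q⁻¹ y n
        ≈⟨ Q-inverse nil n ⟩
      𝟙 ∎
      where
      Y = y ^ suc n ; u = inv⁺ y (suc n) ; v = inv⁻ y (suc n)

    -- θ y n = Q y n + remainder y n n, where the remainder is divisible by y^(n+1):
    -- a finite form of Gauss's product for θ in the style of Shanks, proved by
    -- telescoping the differences remainder y (n+1) j - remainder y n j.
    remainderTerm remainder : Carrier → ℕ → ℕ → Carrier
    remainderTerm y n s = 𝟚 * (sign s * (Q y n * Q⁻¹ y s * y ^ (s ℕ.* suc n) * inv⁺ y s))
    remainder y n zero    = ⟦ + 0 ⟧
    remainder y n (suc j) = remainder y n j + remainderTerm y n (suc j)

    -- Up to the factor 2/(1 + y^(n+1)), its differences in j are the differences in n of the
    -- remainder terms, with opposite sign. Its value at j = 0 accounts for `Q y n - Q y (suc n)`;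
    -- its value at j = n supplies part of the new theta term.
    antidifference : Carrier → ℕ → ℕ → Carrier
    antidifference y n j = sign j * (y ^ (suc j ℕ.* suc n) * (Q y n * Q⁻¹ y j))

    remainder-step : ∀ {y} → Nilpotent y → ∀ n j →
      remainderTerm y (suc n) (suc j) + 𝟚 * (inv⁺ y (suc n) * antidifference y n (suc j))
        ≈ remainderTerm y n (suc j) + 𝟚 * (inv⁺ y (suc n) * antidifference y n j)
    remainder-step {y} nil n j = begin
      remainderTerm y (suc n) (suc j) + 𝟚 * (u * antidifference y n (suc j))
        ≈⟨ +-cong (*-congˡ (*-congˡ (*-congʳ (*-congˡ shiftZ))))
                  (*-congˡ (*-congˡ (*-congˡ (*-congʳ (^-homo-* y (suc n) (suc j ℕ.* suc n)))))) ⟩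
      𝟚 * (- c * (q * ((𝟙 - Y) * u) * (r * ((𝟙 + Z) * v)) * (Z * P) * w))
        + 𝟚 * (u * (- c * ((Y * P) * (q * (r * ((𝟙 + Z) * v))))))
        ≈⟨ solve 9 (λ c q r P Y Z u v w →
             con (+ 2) :* (:- c :* (q :* ((con (+ 1) :- Y) :* u) :* (r :* ((con (+ 1) :+ Z) :* v)) :* (Z :* P) :* w))
               :+ con (+ 2) :* (u :* (:- c :* ((Y :* P) :* (q :* (r :* ((con (+ 1) :+ Z) :* v))))))
             := con (+ 2) :* (c :* q :* r :* P) :* (u :* v :* ((Y :- con (+ 1)) :* Z)) :* ((con (+ 1) :+ Z) :* w)
                :- con (+ 2) :* (c :* q :* r :* P) :* (u :* v :* Y :* (con (+ 1) :+ Z)))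
             refl c q r P Y Z u v w ⟩
      K * (u * v * ((Y - 𝟙) * Z)) * ((𝟙 + Z) * w) - K * (u * v * Y * (𝟙 + Z))
        ≈⟨ +-congʳ (*-cancel-𝟙 invZ⁺) ⟩
      K * (u * v * ((Y - 𝟙) * Z)) - K * (u * v * Y * (𝟙 + Z))
        -- The numerator (Y - 1)Z - Y(1 + Z) = -(Y + Z) is split as (1 - Z) - (1 + Y), so that each
        -- half cancels one of the denominators 1 - Z and 1 + Y.
        ≈⟨ solve 5 (λ K Y Z u v →
             K :* (u :* v :* ((Y :- con (+ 1)) :* Z)) :- K :* (u :* v :* Y :* (con (+ 1) :+ Z))
             := :- (K :* v :* ((con (+ 1) :+ Y) :* u)) :+ K :* u :* ((con (+ 1) :- Z) :* v))
             refl K Y Z u v ⟩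
      - (K * v * ((𝟙 + Y) * u)) + K * u * ((𝟙 - Z) * v)
        ≈⟨ +-cong (-‿cong (trans (*-cancel-𝟙 (inv⁺-inverse nil n)) (sym (*-cancel-𝟙 invZ⁺))))
                  (*-cancel-𝟙 (inv⁻-inverse nil j)) ⟩
      - (K * v * ((𝟙 + Z) * w)) + K * u
        ≈⟨ solve 8 (λ c q r P Z u v w →
             :- (con (+ 2) :* (c :* q :* r :* P) :* v :* ((con (+ 1) :+ Z) :* w)) :+ con (+ 2) :* (c :* q :* r :* P) :* u
             := con (+ 2) :* (:- c :* (q :* (r :* ((con (+ 1) :+ Z) :* v)) :* P :* w))
                :+ con (+ 2) :* (u :* (c :* (P :* (q :* r)))))
             refl c q r P Z u v w ⟩
      remainderTerm y n (suc j) + 𝟚 * (u * antidifference y n j) ∎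
      where
      Y = y ^ suc n ; Z = y ^ suc j ; P = y ^ (suc j ℕ.* suc n)
      u = inv⁺ y (suc n) ; v = inv⁻ y (suc j) ; w = inv⁺ y (suc j)
      c = sign j ; q = Q y n ; r = Q⁻¹ y j ; K = 𝟚 * (c * q * r * P)
      invZ⁺ : (𝟙 + Z) * w ≈ 𝟙
      invZ⁺ = inv⁺-inverse nil j
      shiftZ : y ^ (suc j ℕ.* suc (suc n)) ≈ Z * P
      shiftZ = trans (^-congʳ y (ℕₚ.*-suc (suc j) (suc n))) (^-homo-* y (suc j) (suc j ℕ.* suc n))

    remainder-telescope : ∀ {y} → Nilpotent y → ∀ n j →
      remainder y (suc n) j + 𝟚 * (inv⁺ y (suc n) * antidifference y n j)
        ≈ remainder y n j + 𝟚 * (inv⁺ y (suc n) * antidifference y n 0)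
    remainder-telescope nil n zero = refl
    remainder-telescope {y} nil n (suc j) = begin
      remainder y (suc n) j + remainderTerm y (suc n) (suc j) + up (suc j)
        ≈⟨ trans (+-assoc _ _ _) (+-congˡ (remainder-step nil n j)) ⟩
      remainder y (suc n) j + (remainderTerm y n (suc j) + up j)
        ≈⟨ solve 3 (λ a b c → a :+ (b :+ c) := a :+ c :+ b) refl _ _ _ ⟩
      remainder y (suc n) j + up j + remainderTerm y n (suc j)
        ≈⟨ +-congʳ (remainder-telescope nil n j) ⟩
      remainder y n j + up 0 + remainderTerm y n (suc j)
        ≈⟨ solve 3 (λ a b c → a :+ c :+ b := a :+ b :+ c) refl _ _ _ ⟩
      remainder y n j + remainderTerm y n (suc j) + up 0 ∎
      where
      up : ℕ → Carrier
      up i = 𝟚 * (inv⁺ y (suc n) * antidifference y n i)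

    θ-finite-product : ∀ {y} → Nilpotent y → ∀ n → θ y n ≈ Q y n + remainder y n n
    θ-finite-product nil zero = solve 0 (con (+ 1) := con (+ 1) :+ con (+ 0)) refl
    θ-finite-product {y} nil (suc n) = begin
      θ y n + 𝟚 * (- c * X)
        ≈⟨ +-congʳ (θ-finite-product nil n) ⟩
      q + ρ + 𝟚 * (- c * X)
        -- Inserting (1 + Y)u = 1 exposes q - q(1 - Y)u = 2uYq, the boundary term of the telescoping
        -- at j = 0. It also splits the new theta term into the boundary term at j = n and the last
        -- term of the new remainder.
        ≈⟨ +-cong (+-congʳ (sym (*-cancel-𝟙 invY))) (sym (*-cancel-𝟙 invY)) ⟩
      q * ((𝟙 + Y) * u) + ρ + 𝟚 * (- c * X) * ((𝟙 + Y) * u)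
        ≈⟨ solve 6 (λ q ρ Y u c X →
             q :* ((con (+ 1) :+ Y) :* u) :+ ρ :+ con (+ 2) :* (:- c :* X) :* ((con (+ 1) :+ Y) :* u)
             := q :* ((con (+ 1) :- Y) :* u) :+ (ρ :+ con (+ 2) :* (u :* (con (+ 1) :* (Y :* (q :* con (+ 1))))))
                :- con (+ 2) :* (u :* (c :* X))
                :+ con (+ 2) :* (:- c :* (Y :* X :* u)))
             refl q ρ Y u c X ⟩
      q * ((𝟙 - Y) * u) + (ρ + 𝟚 * (u * (𝟙 * (Y * (q * 𝟙))))) - 𝟚 * (u * (c * X))
        + 𝟚 * (- c * (Y * X * u))
        ≈⟨ +-congʳ (+-congʳ (+-congˡ (trans (+-congˡ (*-congˡ (*-congˡ (*-congˡ (*-congʳ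
             (^-congʳ y (≡.sym (ℕₚ.*-identityˡ (suc n)))))))))
             (sym (remainder-telescope nil n n))))) ⟩
      q * ((𝟙 - Y) * u) + (ρ′ + 𝟚 * (u * antidifference y n n)) - 𝟚 * (u * (c * X))
        + 𝟚 * (- c * (Y * X * u))
        ≈⟨ +-congʳ (+-congʳ (+-congˡ (+-congˡ (*-congˡ (*-congˡ (*-congˡ
             (*-cancel-𝟙 (Q-inverse nil n)))))))) ⟩
      q * ((𝟙 - Y) * u) + (ρ′ + 𝟚 * (u * (c * X))) - 𝟚 * (u * (c * X))
        + 𝟚 * (- c * (Y * X * u))
        ≈⟨ solve 4 (λ a b c d → a :+ (b :+ c) :- c :+ d := a :+ (b :+ d)) refl _ _ _ _ ⟩
      q * ((𝟙 - Y) * u) + (ρ′ + 𝟚 * (- c * (Y * X * u)))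
        ≈⟨ +-congˡ (+-congˡ (*-congˡ (*-congˡ (*-congʳ
             (sym (trans (*-comm _ _) (trans (*-cancel-𝟙 (Q-inverse nil (suc n))) shiftX))))))) ⟩
      Q y (suc n) + (ρ′ + remainderTerm y (suc n) (suc n)) ∎
      where
      X = y ^ (suc n ℕ.* suc n) ; Y = y ^ suc n ; u = inv⁺ y (suc n)
      c = sign n ; q = Q y n ; ρ = remainder y n n ; ρ′ = remainder y (suc n) n
      invY : (𝟙 + Y) * u ≈ 𝟙
      invY = inv⁺-inverse nil n
      shiftX : y ^ (suc n ℕ.* suc (suc n)) ≈ Y * X
      shiftX = trans (^-congʳ y (ℕₚ.*-suc (suc n) (suc n))) (^-homo-* y (suc n) (suc n ℕ.* suc n))

    remainder≈0 : ∀ {y n} → y ^ suc n ≈ 0# → ∀ j → remainder y n j ≈ 0#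
    remainder≈0 _ zero = 0-homo
    remainder≈0 {y} {n} y^n≈0 (suc j) = begin
      remainder y n j + remainderTerm y n (suc j)
        ≈⟨ +-cong (remainder≈0 y^n≈0 j) (zeroᵐ (zeroᵐ (trans (*-congʳ (zeroᵐ power≈0)) (zeroˡ _)))) ⟩
      0# + 0# ≈⟨ +-identityˡ 0# ⟩
      0#      ∎
      where
      power≈0 : y ^ (suc j ℕ.* suc n) ≈ 0#
      power≈0 = trans (^-homo-* y (suc n) (j ℕ.* suc n)) (trans (*-congʳ y^n≈0) (zeroˡ _))

    θ≈Q : ∀ {y n} → Nilpotent y → M ℕ.≤ n → θ y n ≈ Q y n
    θ≈Q {y} {n} nil M≤n = begin
      θ y n                    ≈⟨ θ-finite-product nil n ⟩
      Q y n + remainder y n n  ≈⟨ +-congˡ (remainder≈0 (nilpotent-≥ nil (s≤s M≤n)) n) ⟩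
      Q y n + 0#               ≈⟨ +-identityʳ _ ⟩
      Q y n                    ∎

    -- Terms with s > M vanish because s² ≥ s. This leaves the cut-off free to suit each dissection.
    θ-stable : ∀ {y n} → Nilpotent y → M ℕ.≤ n → θ y n ≈ θ y M
    θ-stable {y} {n} nil M≤n = trans (reflexive (≡.cong (θ y) (≡.sym (ℕₚ.m∸n+n≡m M≤n)))) (go (n ℕ.∸ M))
      where
      go : ∀ d → θ y (d ℕ.+ M) ≈ θ y M
      go zero    = refl
      go (suc d) = begin
        θ y (d ℕ.+ M) + 𝟚 * (sign s * y ^ (s ℕ.* s))
          ≈⟨ +-cong (go d) (zeroᵐ (zeroᵐ (nilpotent-≥ nil (ℕₚ.≤-trans (s≤s (ℕₚ.m≤n+m M d)) (ℕₚ.m≤m*n s s))))) ⟩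
        θ y M + 0# ≈⟨ +-identityʳ _ ⟩
        θ y M      ∎
        where s = suc (d ℕ.+ M)

    inv-cong : ∀ {y z} → y ≈ z → inv y ≈ inv z
    inv-cong {y} {z} y≈z = go M
      where
      go : ∀ n → geometric n y ≈ geometric n z
      go zero    = refl
      go (suc n) = +-cong (go n) (^-congˡ (suc n) y≈z)

    θ-cong : ∀ {y z} n → y ≈ z → θ y n ≈ θ z n
    θ-cong zero    y≈z = refl
    θ-cong (suc n) y≈z = +-cong (θ-cong n y≈z) (*-congˡ (*-congˡ (^-congˡ (suc n ℕ.* suc n) y≈z)))

    oddProduct : Carrier → ℕ → Carrier
    oddProduct y zero    = 𝟙
    oddProduct y (suc J) =
      (𝟙 + y ^ suc (J ℕ.* 2)) * inv⁻ y (suc (J ℕ.* 2)) * oddProduct y J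

    -- The factors of `Q y` with odd index are reciprocal to those of `oddProduct`; those with even
    -- index are the factors of `Q` at y². This is the finite form of G(y) θ(y) = θ(y²).
    oddProduct-Q : ∀ {y} → Nilpotent y → ∀ J → oddProduct y J * Q y (J ℕ.* 2) ≈ Q (y ^ 2) J
    oddProduct-Q nil zero = solve 0 (con (+ 1) :* con (+ 1) := con (+ 1)) refl
    oddProduct-Q {y} nil (suc J) = begin
      (𝟙 + Y₁) * v₁ * oddProduct y J * (Q y (J ℕ.* 2) * ((𝟙 - Y₁) * u₁) * ((𝟙 - Y₂) * u₂))
        ≈⟨ solve 7 (λ o q Y₁ Y₂ u₁ v₁ u₂ →
             (con (+ 1) :+ Y₁) :* v₁ :* o :* (q :* ((con (+ 1) :- Y₁) :* u₁) :* ((con (+ 1) :- Y₂) :* u₂))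
             := o :* q :* ((con (+ 1) :- Y₂) :* u₂) :* ((con (+ 1) :+ Y₁) :* u₁) :* ((con (+ 1) :- Y₁) :* v₁))
             refl (oddProduct y J) (Q y (J ℕ.* 2)) Y₁ Y₂ u₁ v₁ u₂ ⟩
      oddProduct y J * Q y (J ℕ.* 2) * ((𝟙 - Y₂) * u₂) * ((𝟙 + Y₁) * u₁) * ((𝟙 - Y₁) * v₁)
        ≈⟨ trans (*-cancel-𝟙 (inv⁻-inverse nil (J ℕ.* 2))) (*-cancel-𝟙 (inv⁺-inverse nil (J ℕ.* 2))) ⟩
      oddProduct y J * Q y (J ℕ.* 2) * ((𝟙 - Y₂) * u₂)
        ≈⟨ *-cong (oddProduct-Q nil J)
             (*-cong (+-congˡ (-‿cong square)) (inv-cong (-‿cong square))) ⟩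
      Q (y ^ 2) (suc J) ∎
      where
      Y₁ = y ^ suc (J ℕ.* 2) ; Y₂ = y ^ (suc J ℕ.* 2)
      u₁ = inv⁺ y (suc (J ℕ.* 2)) ; v₁ = inv⁻ y (suc (J ℕ.* 2)) ; u₂ = inv⁺ y (suc J ℕ.* 2)
      square : Y₂ ≈ (y ^ 2) ^ suc J
      square = trans (^-congʳ y (ℕₚ.*-comm (suc J) 2)) (sym (^-assocʳ y 2 (suc J)))

    -- For odd k, (-y)^k = -y^k interchanges numerator and denominator of each factor.
    oddProduct-neg : ∀ {y} → Nilpotent y → ∀ J → oddProduct y J * oddProduct (- y) J ≈ 𝟙
    oddProduct-neg nil zero = solve 0 (con (+ 1) :* con (+ 1) := con (+ 1)) refl
    oddProduct-neg {y} nil (suc J) = begin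
      (𝟙 + Y) * v * oddProduct y J * ((𝟙 + (- y) ^ suc (J ℕ.* 2)) * inv⁻ (- y) (suc (J ℕ.* 2)) * oddProduct (- y) J)
        ≈⟨ *-congˡ (*-congʳ (*-cong (+-congˡ (neg-odd y J)) (inv-cong (neg-odd y J)))) ⟩
      (𝟙 + Y) * v * oddProduct y J * ((𝟙 - Y) * u * oddProduct (- y) J)
        ≈⟨ solve 5 (λ o p Y u v →
             (con (+ 1) :+ Y) :* v :* o :* ((con (+ 1) :- Y) :* u :* p)
             := o :* p :* ((con (+ 1) :+ Y) :* u) :* ((con (+ 1) :- Y) :* v))
             refl (oddProduct y J) (oddProduct (- y) J) Y u v ⟩
      oddProduct y J * oddProduct (- y) J * ((𝟙 + Y) * u) * ((𝟙 - Y) * v)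
        ≈⟨ trans (*-cancel-𝟙 (inv⁻-inverse nil (J ℕ.* 2))) (*-cancel-𝟙 (inv⁺-inverse nil (J ℕ.* 2))) ⟩
      oddProduct y J * oddProduct (- y) J
        ≈⟨ oddProduct-neg nil J ⟩
      𝟙 ∎
      where
      Y = y ^ suc (J ℕ.* 2) ; u = inv⁺ y (suc (J ℕ.* 2)) ; v = inv⁻ y (suc (J ℕ.* 2))

    oddProduct-θ : ∀ {y J} → Nilpotent y → M ℕ.≤ J → oddProduct y J * θ y M ≈ θ (y ^ 2) M
    oddProduct-θ {y} {J} nil M≤J = begin
      oddProduct y J * θ y M          ≈⟨ *-congˡ (θ-stable nil M≤2J) ⟨
      oddProduct y J * θ y (J ℕ.* 2)  ≈⟨ *-congˡ (θ≈Q nil M≤2J) ⟩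
      oddProduct y J * Q y (J ℕ.* 2)  ≈⟨ oddProduct-Q nil J ⟩
      Q (y ^ 2) J                     ≈⟨ θ≈Q nil² M≤J ⟨
      θ (y ^ 2) J                     ≈⟨ θ-stable nil² M≤J ⟩
      θ (y ^ 2) M                     ∎
      where
      M≤2J = ℕₚ.≤-trans M≤J (ℕₚ.m≤m*n J 2)
      nil² = nilpotent-^ nil 1

    neg-square : ∀ y → (- y) ^ 2 ≈ y ^ 2
    neg-square y = solve 1 (λ y → (:- y) :^ 2 := y :^ 2) refl y

    -- θ(y²) = G(-y) θ(-y) by `oddProduct-θ` at -y, and G(y) G(-y) = 1.
    oddProduct-θ-neg : ∀ {y J} → Nilpotent y → M ℕ.≤ J → oddProduct y J * θ (y ^ 2) M ≈ θ (- y) M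
    oddProduct-θ-neg {y} {J} nil M≤J = begin
      oddProduct y J * θ (y ^ 2) M
        ≈⟨ *-congˡ (trans (oddProduct-θ (nilpotent-neg nil) M≤J) (θ-cong M (neg-square y))) ⟨
      oddProduct y J * (oddProduct (- y) J * θ (- y) M)
        ≈⟨ solve 3 (λ a b c → a :* (b :* c) := c :* (a :* b)) refl _ _ _ ⟩
      θ (- y) M * (oddProduct y J * oddProduct (- y) J)
        ≈⟨ *-cancel-𝟙 (oddProduct-neg nil J) ⟩
      θ (- y) M ∎

    θ-neg-θ : ∀ {y} → Nilpotent y → θ (y ^ 2) M * θ (y ^ 2) M ≈ θ y M * θ (- y) M
    θ-neg-θ {y} nil = begin
      θ (y ^ 2) M * θ (y ^ 2) M
        ≈⟨ *-congʳ (oddProduct-θ nil ℕₚ.≤-refl) ⟨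
      oddProduct y M * θ y M * θ (y ^ 2) M
        ≈⟨ solve 3 (λ a b c → a :* b :* c := b :* (a :* c)) refl _ _ _ ⟩
      θ y M * (oddProduct y M * θ (y ^ 2) M)
        ≈⟨ *-congˡ (oddProduct-θ-neg nil ℕₚ.≤-refl) ⟩
      θ y M * θ (- y) M ∎

    -- The squares on the left factor as θ(q²) θ(-q²) and θ(q¹⁸) θ(-q¹⁸). Then θ(q¹⁸) = G(q⁹) θ(q⁹)
    -- supplies the G(q⁹) that turns F into G(q), and θ(q²) turns G(q) into θ(-q).
    quotient-θ : ∀ {q F J} → Nilpotent q → M ℕ.≤ J → F * oddProduct (q ^ 9) J ≈ oddProduct q J →
      F * (θ (q ^ 4) M * θ (q ^ 4) M * (θ (q ^ 36) M * θ (q ^ 36) M))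
        ≈ θ (- q) M * θ (q ^ 9) M * (θ (- (q ^ 2)) M * θ (- (q ^ 18)) M)
    quotient-θ {q} {F} {J} nil M≤J eq = begin
      F * (θ (q ^ 4) M * θ (q ^ 4) M * (θ (q ^ 36) M * θ (q ^ 36) M))
        ≈⟨ *-congˡ (*-cong (squares 1) (squares 17)) ⟩
      F * (Z * Z′ * (U * U′))
        ≈⟨ *-congˡ (*-congˡ (*-congʳ (trans (oddProduct-θ (nilpotent-^ nil 8) M≤J) (θ-cong M (^-assocʳ q 9 2))))) ⟨
      F * (Z * Z′ * (oddProduct (q ^ 9) J * Y * U′))
        ≈⟨ solve 6 (λ F Z Z′ G Y U′ → F :* (Z :* Z′ :* (G :* Y :* U′)) := F :* G :* Z :* Y :* (Z′ :* U′))
             refl F Z Z′ (oddProduct (q ^ 9) J) Y U′ ⟩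
      F * oddProduct (q ^ 9) J * Z * Y * (Z′ * U′)
        ≈⟨ *-congʳ (*-congʳ (trans (*-congʳ eq) (oddProduct-θ-neg nil M≤J))) ⟩
      θ (- q) M * Y * (Z′ * U′) ∎
      where
      Z = θ (q ^ 2) M ; Z′ = θ (- (q ^ 2)) M ; Y = θ (q ^ 9) M
      U = θ (q ^ 18) M ; U′ = θ (- (q ^ 18)) M
      squares : ∀ k → θ (q ^ (suc k ℕ.* 2)) M * θ (q ^ (suc k ℕ.* 2)) M
                        ≈ θ (q ^ suc k) M * θ (- (q ^ suc k)) M
      squares k = trans (*-cong e e) (θ-neg-θ (nilpotent-^ nil k))
        where e = θ-cong M (sym (^-assocʳ q (suc k) 2))

    -- The quotient F and its congruence modulo 2

    Odd : Carrier → Set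
    Odd F = ∃ λ f → F ≈ 𝟙 + 𝟚 * f

    odd-* : ∀ {F G} → Odd F → Odd G → Odd (F * G)
    odd-* (f , e) (g , e′) = f + g + 𝟚 * (f * g) , trans (*-cong e e′)
      (solve 2 (λ f g → (con (+ 1) :+ con (+ 2) :* f) :* (con (+ 1) :+ con (+ 2) :* g)
        := con (+ 1) :+ con (+ 2) :* (f :+ g :+ con (+ 2) :* (f :* g))) refl f g)

    -- (1 + x)/(1 - x) = 1 + 2x/(1 - x) and (1 - y)/(1 + y) = 1 - 2y/(1 + y).
    odd-factor : ∀ {x y a b} → (𝟙 + y) * a ≈ 𝟙 → (𝟙 - x) * b ≈ 𝟙 →
      Odd ((𝟙 + x) * (𝟙 - y) * (a * b))
    odd-factor {x} {y} {a} {b} ya xb = proj₁ odd , trans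
      (solve 4 (λ x y a b → (con (+ 1) :+ x) :* (con (+ 1) :- y) :* (a :* b)
        := ((con (+ 1) :+ x) :* b) :* ((con (+ 1) :- y) :* a)) refl x y a b) (proj₂ odd)
      where
      odd : Odd (((𝟙 + x) * b) * ((𝟙 - y) * a))
      odd = odd-*
        (x * b , trans (solve 2 (λ x b → (con (+ 1) :+ x) :* b := (con (+ 1) :- x) :* b :+ con (+ 2) :* (x :* b)) refl x b)
                       (+-congʳ xb))
        (- (y * a) , trans (solve 2 (λ y a → (con (+ 1) :- y) :* a
                             := (con (+ 1) :+ y) :* a :+ con (+ 2) :* (:- (y :* a))) refl y a) (+-congʳ ya))

    quotient-factor : ∀ {x y a b} → Nilpotent x → Nilpotent y → (𝟙 + y) * a ≈ 𝟙 → (𝟙 - x) * b ≈ 𝟙 →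
      (𝟙 + x) * (𝟙 - y) * (a * b) * ((𝟙 + y) * inv y) ≈ (𝟙 + x) * inv x
    quotient-factor {x} {y} {a} {b} nilx nily ya xb = begin
      (𝟙 + x) * (𝟙 - y) * (a * b) * ((𝟙 + y) * inv y)
        ≈⟨ solve 5 (λ x y a b i → (con (+ 1) :+ x) :* (con (+ 1) :- y) :* (a :* b) :* ((con (+ 1) :+ y) :* i)
             := (con (+ 1) :+ x) :* b :* ((con (+ 1) :+ y) :* a) :* ((con (+ 1) :- y) :* i)) refl x y a b (inv y) ⟩
      (𝟙 + x) * b * ((𝟙 + y) * a) * ((𝟙 - y) * inv y)
        ≈⟨ trans (*-cancel-𝟙 (inv-inverse nily)) (*-cancel-𝟙 ya) ⟩
      (𝟙 + x) * b
        ≈⟨ *-congˡ (inverse-unique xb (inv-inverse nilx)) ⟩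
      (𝟙 + x) * inv x ∎

    -- The reciprocals are abstract, so that the explicit series of the definition can be
    -- substituted for them; uniqueness of inverses reconciles them with `inv`.
    module _ {q} (nil : Nilpotent q) (a b F : ℕ → Carrier)
      (a-inverse : ∀ j → (𝟙 + q ^ suc (18 ℕ.* j ℕ.+ 8)) * a j ≈ 𝟙)
      (b-inverse : ∀ j → (𝟙 - q ^ suc (2 ℕ.* j)) * b j ≈ 𝟙)
      (F-zero : F 0 ≈ 𝟙)
      (F-suc : ∀ j → F (suc j)
        ≈ (𝟙 + q ^ suc (2 ℕ.* j)) * (𝟙 - q ^ suc (18 ℕ.* j ℕ.+ 8)) * (a j * b j) * F j) where

      quotient-odd : ∀ J → Odd (F J)
      quotient-odd zero = ⟦ + 0 ⟧ , trans F-zero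
        (solve 0 (con (+ 1) := con (+ 1) :+ con (+ 2) :* con (+ 0)) refl)
      quotient-odd (suc J) = proj₁ odd , trans (F-suc J) (proj₂ odd)
        where odd = odd-* (odd-factor (a-inverse J) (b-inverse J)) (quotient-odd J)

      quotient-oddProduct : ∀ J → F J * oddProduct (q ^ 9) J ≈ oddProduct q J
      quotient-oddProduct zero = trans (*-congʳ F-zero) (*-cancel-𝟙 refl)
      quotient-oddProduct (suc J) = begin
        F (suc J) * ((𝟙 + y) * inv y * oddProduct (q ^ 9) J)
          ≈⟨ *-congʳ (trans (F-suc J) (*-congʳ (*-congʳ (*-cong (+-congˡ x≈) (+-congˡ (-‿cong y≈)))))) ⟩
        (𝟙 + x) * (𝟙 - y) * (a J * b J) * F J * ((𝟙 + y) * inv y * oddProduct (q ^ 9) J)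
          ≈⟨ solve 4 (λ a b c d → a :* b :* (c :* d) := (a :* c) :* (b :* d)) refl _ _ _ _ ⟩
        (𝟙 + x) * (𝟙 - y) * (a J * b J) * ((𝟙 + y) * inv y) * (F J * oddProduct (q ^ 9) J)
          ≈⟨ *-cong (quotient-factor (nilpotent-^ nil (J ℕ.* 2)) (nilpotent-^ (nilpotent-^ nil 8) (J ℕ.* 2))
               (trans (*-congʳ (+-congˡ (sym y≈))) (a-inverse J))
               (trans (*-congʳ (+-congˡ (-‿cong (sym x≈)))) (b-inverse J)))
               (quotient-oddProduct J) ⟩
        (𝟙 + x) * inv x * oddProduct q J ∎
        where
        x = q ^ suc (J ℕ.* 2) ; y = (q ^ 9) ^ suc (J ℕ.* 2)
        x≈ : q ^ suc (2 ℕ.* J) ≈ x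
        x≈ = ^-congʳ q (≡.cong suc (ℕₚ.*-comm 2 J))
        y≈ : q ^ suc (18 ℕ.* J ℕ.+ 8) ≈ y
        y≈ = trans (^-congʳ q (Arithmetic.nine-odd J))
             (sym (^-assocʳ q 9 (suc (J ℕ.* 2))))

  -- Dissection of the theta series

  ∑ : ℕ → (ℕ → Carrier) → Carrier
  ∑ zero    f = ⟦ + 0 ⟧
  ∑ (suc n) f = ∑ n f + f n

  ∑-cong : ∀ {f g} → (∀ t → f t ≈ g t) → ∀ n → ∑ n f ≈ ∑ n g
  ∑-cong e zero    = refl
  ∑-cong e (suc n) = +-cong (∑-cong e n) (e n)

  ∑-+ : ∀ f g n → ∑ n (λ t → f t + g t) ≈ ∑ n f + ∑ n g
  ∑-+ f g zero    = solve 0 (con (+ 0) := con (+ 0) :+ con (+ 0)) refl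
  ∑-+ f g (suc n) = trans (+-congʳ (∑-+ f g n))
    (solve 4 (λ a b c d → a :+ b :+ (c :+ d) := a :+ c :+ (b :+ d)) refl _ _ _ _)

  ∑-neg : ∀ f n → ∑ n (λ t → - f t) ≈ - ∑ n f
  ∑-neg f zero    = solve 0 (con (+ 0) := :- con (+ 0)) refl
  ∑-neg f (suc n) = trans (+-congʳ (∑-neg f n))
    (solve 2 (λ a b → :- a :+ :- b := :- (a :+ b)) refl _ _)

  θ-∑ : ∀ y n → θ y n ≈ 𝟙 + 𝟚 * ∑ n (λ s → sign (suc s) * y ^ (suc s ℕ.* suc s))
  θ-∑ y zero    = solve 0 (con (+ 1) := con (+ 1) :+ con (+ 2) :* con (+ 0)) refl
  θ-∑ y (suc n) = trans (+-congʳ (θ-∑ y n))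
    (solve 2 (λ a b → con (+ 1) :+ con (+ 2) :* a :+ con (+ 2) :* b := con (+ 1) :+ con (+ 2) :* (a :+ b)) refl _ _)

  square-^ : Carrier → ℕ → Carrier
  square-^ y s = y ^ (s ℕ.* s)

  -- s² and s have the same parity, so the sign of (-y)^(s²) cancels the sign of the term.
  θ-neg-∑ : ∀ y n → θ (- y) n ≈ 𝟙 + 𝟚 * ∑ n (λ s → square-^ y (suc s))
  θ-neg-∑ y n = trans (θ-∑ (- y) n) (+-congˡ (*-congˡ (∑-cong (λ s → term (suc s)) n)))
    where
    sign-square : ∀ s → sign (s ℕ.* s) ≈ sign s
    sign-+ : ∀ m n → sign (m ℕ.+ n) ≈ sign m * sign n
    sign-+ zero    n = solve 1 (λ x → x := con (+ 1) :* x) refl _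
    sign-+ (suc m) n = trans (-‿cong (sign-+ m n)) (solve 2 (λ x y → :- (x :* y) := :- x :* y) refl _ _)
    sign-² : ∀ s → sign s * sign s ≈ 𝟙
    sign-² zero    = solve 0 (con (+ 1) :* con (+ 1) := con (+ 1)) refl
    sign-² (suc s) = trans (solve 1 (λ x → :- x :* :- x := x :* x) refl _) (sign-² s)
    sign-square zero    = refl
    sign-square (suc s) = begin
      - sign (s ℕ.+ s ℕ.* suc s)          ≡⟨ ≡.cong (λ k → - sign (s ℕ.+ k)) (ℕₚ.*-suc s s) ⟩
      - sign (s ℕ.+ (s ℕ.+ s ℕ.* s))      ≈⟨ -‿cong (trans (sign-+ s _) (trans (*-congˡ (sign-+ s _)) (*-congˡ (*-congˡ (sign-square s))))) ⟩
      - (sign s * (sign s * sign s))      ≈⟨ -‿cong (*-cancel-𝟙 (sign-² s)) ⟩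
      - sign s                            ∎
    term : ∀ s → sign s * (- y) ^ (s ℕ.* s) ≈ y ^ (s ℕ.* s)
    term s = begin
      sign s * (- y) ^ (s ℕ.* s)          ≈⟨ *-congˡ (trans (neg-^ y (s ℕ.* s)) (*-congʳ (sign-square s))) ⟩
      sign s * (sign s * y ^ (s ℕ.* s))   ≈⟨ solve 2 (λ c z → c :* (c :* z) := z :* (c :* c)) refl _ _ ⟩
      y ^ (s ℕ.* s) * (sign s * sign s)   ≈⟨ *-cancel-𝟙 (sign-² s) ⟩
      y ^ (s ℕ.* s)                       ∎

  ∑-blocks₂ : ∀ f n → ∑ (n ℕ.* 2) f ≈ ∑ n (λ t → f (t ℕ.* 2)) + ∑ n (λ t → f (1 ℕ.+ t ℕ.* 2))
  ∑-blocks₂ f n = trans (go n) (∑-+ _ _ n)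
    where
    go : ∀ n → ∑ (n ℕ.* 2) f ≈ ∑ n (λ t → f (t ℕ.* 2) + f (1 ℕ.+ t ℕ.* 2))
    go zero    = refl
    go (suc n) = trans (+-assoc _ _ _) (+-congʳ (go n))

  ∑-blocks₃ : ∀ f n → ∑ (n ℕ.* 3) f
    ≈ ∑ n (λ t → f (t ℕ.* 3) + f (1 ℕ.+ t ℕ.* 3)) + ∑ n (λ t → f (2 ℕ.+ t ℕ.* 3))
  ∑-blocks₃ f n = trans (go n) (∑-+ _ _ n)
    where
    go : ∀ n → ∑ (n ℕ.* 3) f ≈ ∑ n (λ t → f (t ℕ.* 3) + f (1 ℕ.+ t ℕ.* 3) + f (2 ℕ.+ t ℕ.* 3))
    go zero    = refl
    go (suc n) = trans (+-congʳ (+-congʳ (+-congʳ (go n))))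
      (solve 4 (λ a b c d → a :+ b :+ c :+ d := a :+ (b :+ c :+ d)) refl _ _ _ _)

  module Dissection (q : Carrier) (L : ℕ) where

    -- The classes s ≡ ±1, ±2, 3, 0 modulo 6: β and γ carry the odd exponents s², β and δ those ≡ 1
    -- (mod 3), γ and ε those divisible by 3.
    β δ γ ε : Carrier
    β = ∑ L (λ t → square-^ q (1 ℕ.+ t ℕ.* 6) + square-^ q (5 ℕ.+ t ℕ.* 6))
    δ = ∑ L (λ t → square-^ q (2 ℕ.+ t ℕ.* 6) + square-^ q (4 ℕ.+ t ℕ.* 6))
    γ = ∑ L (λ t → square-^ q (3 ℕ.+ t ℕ.* 6))
    ε = ∑ L (λ t → square-^ q (6 ℕ.+ t ℕ.* 6))

    θ-neg-dissection : θ (- q) (L ℕ.* 6) ≈ 𝟙 + 𝟚 * (β + δ + γ + ε)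
    θ-neg-dissection = trans (θ-neg-∑ q (L ℕ.* 6)) (+-congˡ (*-congˡ
      (trans (go L) (trans (∑-+ _ _ L) (+-congʳ (trans (∑-+ _ _ L) (+-congʳ (∑-+ _ _ L))))))))
      where
      f : ℕ → Carrier
      f s = square-^ q (suc s)
      go : ∀ n → ∑ (n ℕ.* 6) f ≈ ∑ n (λ t →
        (f (t ℕ.* 6) + f (4 ℕ.+ t ℕ.* 6)) + (f (1 ℕ.+ t ℕ.* 6) + f (3 ℕ.+ t ℕ.* 6))
          + f (2 ℕ.+ t ℕ.* 6) + f (5 ℕ.+ t ℕ.* 6))
      go zero    = refl
      go (suc n) = trans (+-congʳ (+-congʳ (+-congʳ (+-congʳ (+-congʳ (+-congʳ (go n)))))))
        (solve 7 (λ z a b c d e g → z :+ a :+ b :+ c :+ d :+ e :+ g := z :+ (a :+ e :+ (b :+ d) :+ c :+ g))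
          refl _ _ _ _ _ _ _)

    -- Since 9s² = (3s)², the pieces of θ(-q) with 3 | s return, signed by the parity of s. The
    -- cut-off 2L corresponds exactly to 6L there, so the finite sums are the same elements γ and ε.
    θ-nine-dissection : θ (q ^ 9) (L ℕ.* 2) ≈ 𝟙 + 𝟚 * (ε - γ)
    θ-nine-dissection = trans (θ-∑ (q ^ 9) (L ℕ.* 2)) (+-congˡ (*-congˡ (begin
      ∑ (L ℕ.* 2) f
        ≈⟨ ∑-blocks₂ f L ⟩
      ∑ L (λ t → f (t ℕ.* 2)) + ∑ L (λ t → f (1 ℕ.+ t ℕ.* 2))
        ≈⟨ +-cong (trans (∑-cong odd L) (∑-neg _ L)) (∑-cong even L) ⟩
      - γ + ε
        ≈⟨ +-comm _ _ ⟩
      ε - γ ∎)))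
      where
      f : ℕ → Carrier
      f s = sign (suc s) * square-^ (q ^ 9) (suc s)
      nine : ∀ s s′ → s′ ≡ 3 ℕ.* s → square-^ (q ^ 9) s ≈ square-^ q s′
      nine s _ ≡.refl = trans (^-assocʳ q 9 (s ℕ.* s)) (^-congʳ q
        (Arithmetic.nine-squares s))
      odd : ∀ t → f (t ℕ.* 2) ≈ - square-^ q (3 ℕ.+ t ℕ.* 6)
      odd t = trans (*-cong (-‿cong (sign-double t)) (nine (1 ℕ.+ t ℕ.* 2) (3 ℕ.+ t ℕ.* 6)
          (Arithmetic.triple-odd t)))
        (solve 1 (λ z → :- con (+ 1) :* z := :- z) refl _)
      even : ∀ t → f (1 ℕ.+ t ℕ.* 2) ≈ square-^ q (6 ℕ.+ t ℕ.* 6)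
      even t = trans (*-cong (sign-double (suc t)) (nine (2 ℕ.+ t ℕ.* 2) (6 ℕ.+ t ℕ.* 6)
          (Arithmetic.triple-even t)))
        (solve 1 (λ z → con (+ 1) :* z := z) refl _)

    -- The terms of (θ(q⁴) - 1)/2 with s prime to 3, of exponent 4s² ≡ 1 (mod 3), and those with 3 |
    -- s.
    g₁ g₀ : Carrier
    g₁ = ∑ L (λ t → sign (1 ℕ.+ t ℕ.* 3) * square-^ (q ^ 4) (1 ℕ.+ t ℕ.* 3)
                  + sign (2 ℕ.+ t ℕ.* 3) * square-^ (q ^ 4) (2 ℕ.+ t ℕ.* 3))
    g₀ = ∑ L (λ t → sign (3 ℕ.+ t ℕ.* 3) * square-^ (q ^ 4) (3 ℕ.+ t ℕ.* 3))

    θ-four-dissection : θ (q ^ 4) (L ℕ.* 3) ≈ 𝟙 + 𝟚 * (g₁ + g₀)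
    θ-four-dissection = trans (θ-∑ (q ^ 4) (L ℕ.* 3)) (+-congˡ (*-congˡ (∑-blocks₃ _ L)))

  -- Expansion modulo 16

  eighth-power : ∀ f → ∃ λ κ → (𝟙 + 𝟚 * f) ^ 8 ≈ 𝟙 + ⟦ + 16 ⟧ * κ
  eighth-power f = b + ⟦ + 4 ⟧ * (b * b) , (begin
    -- Three squarings, each doubling the modulus: 1 + 2f, 1 + 4a, 1 + 8b, 1 + 16κ.
    x ^ 8 ≈⟨ trans (sym (^-assocʳ x 2 4)) (^-congˡ 4 (solve 1 (λ f → (con (+ 1) :+ con (+ 2) :* f) :^ 2
                := con (+ 1) :+ con (+ 4) :* (f :+ f :* f)) refl f)) ⟩
    (𝟙 + ⟦ + 4 ⟧ * a) ^ 4
          ≈⟨ trans (sym (^-assocʳ _ 2 2)) (^-congˡ 2 (solve 1 (λ a → (con (+ 1) :+ con (+ 4) :* a) :^ 2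
                := con (+ 1) :+ con (+ 8) :* (a :+ con (+ 2) :* (a :* a))) refl a)) ⟩
    (𝟙 + ⟦ + 8 ⟧ * b) ^ 2
          ≈⟨ solve 1 (λ b → (con (+ 1) :+ con (+ 8) :* b) :^ 2
                := con (+ 1) :+ con (+ 16) :* (b :+ con (+ 4) :* (b :* b))) refl b ⟩
    𝟙 + ⟦ + 16 ⟧ * (b + ⟦ + 4 ⟧ * (b * b)) ∎)
    where
    x = 𝟙 + 𝟚 * f ; a = f + f * f ; b = a + 𝟚 * (a * a)

  power-8m+1 : ∀ {F f} → F ≈ 𝟙 + 𝟚 * f → ∀ m → ∃ λ κ → F ^ (8 ℕ.* m ℕ.+ 1) ≈ F + ⟦ + 16 ⟧ * κ
  power-8m+1 {F} {f} F≈ m with eighth-power f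
  ... | κ , e with powers m
    where
    powers : ∀ m → ∃ λ λ′ → (F ^ 8) ^ m ≈ 𝟙 + ⟦ + 16 ⟧ * λ′
    powers zero = ⟦ + 0 ⟧ , trans (sym 1-homo) (solve 0 (con (+ 1) := con (+ 1) :+ con (+ 16) :* con (+ 0)) refl)
    powers (suc m) with powers m
    ... | μ , e′ = κ + μ + ⟦ + 16 ⟧ * (κ * μ) , trans (*-cong (trans (^-congˡ 8 F≈) e) e′)
      (solve 2 (λ κ μ → (con (+ 1) :+ con (+ 16) :* κ) :* (con (+ 1) :+ con (+ 16) :* μ)
        := con (+ 1) :+ con (+ 16) :* (κ :+ μ :+ con (+ 16) :* (κ :* μ))) refl κ μ)
  ... | μ , e′ = F * μ , (begin
    F ^ (8 ℕ.* m ℕ.+ 1)      ≈⟨ ^-homo-* F (8 ℕ.* m) 1 ⟩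
    F ^ (8 ℕ.* m) * F ^ 1    ≈⟨ *-cong (trans (sym (^-assocʳ F 8 m)) e′) (*-identityʳ F) ⟩
    (𝟙 + ⟦ + 16 ⟧ * μ) * F   ≈⟨ solve 2 (λ F μ → (con (+ 1) :+ con (+ 16) :* μ) :* F := F :+ con (+ 16) :* (F :* μ)) refl F μ ⟩
    F + ⟦ + 16 ⟧ * (F * μ)   ∎)

  -- The parts of θ(-q) θ(q⁹) θ(-q²) θ(-q¹⁸) θ(q⁴)² θ(q³⁶)² in terms of the pieces
  -- of a dissection; c, d and h stand for (θ(-q²)-1)/2, (θ(-q¹⁸)-1)/2 and (θ(q³⁶)-1)/2.
  module Expansion (β δ γ ε g₁ g₀ c d h : Carrier) where

    -- `E` and 2`O` are the parts of θ(-q) θ(q⁹) with even and odd exponents; the products ±2γA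
    -- cancel, which leaves `O` with exponents ≡ 1 (mod 3) only. `W` gathers terms of (1 + 2k)(1 +
    -- 2g)² whose exponents are never ≡ 1 (mod 3), so `O * W` avoids the class 2.
    A k g E O W T² 𝓔 z : Carrier
    A  = 𝟙 + 𝟚 * ε
    k  = c + d + 𝟚 * (c * d)
    g  = g₁ + g₀
    E  = A * A + 𝟚 * (δ * A) - ⟦ + 4 ⟧ * (β * γ + γ * γ)
    O  = β * A - 𝟚 * (δ * γ)
    W  = 𝟙 + ⟦ + 4 ⟧ * (g₀ + g₀ * g₀ + g₁ * g₁) + 𝟚 * (k * (𝟙 + ⟦ + 4 ⟧ * (g₀ + g₀ * g₀)))
    T² = (𝟙 + 𝟚 * h) * (𝟙 + 𝟚 * h)
    𝓔  = E * ((𝟙 + 𝟚 * k) * ((𝟙 + 𝟚 * g) * (𝟙 + 𝟚 * g)) * T²)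
    z  = g + g * g + (h + h * h)

    expansion : ∀ {F f} → F ≈ 𝟙 + 𝟚 * f →
      F * ((𝟙 + 𝟚 * g) * (𝟙 + 𝟚 * g) * T²)
        ≈ (𝟙 + 𝟚 * (β + δ + γ + ε)) * (𝟙 + 𝟚 * (ε - γ)) * ((𝟙 + 𝟚 * c) * (𝟙 + 𝟚 * d)) →
      ∃ λ κ → F ≈ 𝓔 + 𝟚 * (O * W * T²) + ⟦ + 8 ⟧ * (β * g₁) - ⟦ + 8 ⟧ * z + ⟦ + 16 ⟧ * κ
    expansion {F} {f} F≈ eq = κ₁ - κ₂ , (begin
      F
        ≈⟨ solve 3 (λ F z k → F := F :+ con (+ 8) :* z :+ con (+ 16) :* k :- con (+ 8) :* z :- con (+ 16) :* k)
             refl F z κ₂ ⟩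
      F + ⟦ + 8 ⟧ * z + ⟦ + 16 ⟧ * κ₂ - ⟦ + 8 ⟧ * z - ⟦ + 16 ⟧ * κ₂
        -- `eq` is multiplied by the same squares again: a fourth power (1 + 2x)⁴ is 1 + 8(x + x²)
        -- modulo 16, whereas a square is only ≡ 1 (mod 4).
        ≈⟨ +-congʳ (+-congʳ (trans (sym left) (trans (*-congʳ eq) right))) ⟩
      𝓔 + 𝟚 * (O * W * T²) + ⟦ + 8 ⟧ * (β * g₁) + ⟦ + 16 ⟧ * κ₁ - ⟦ + 8 ⟧ * z - ⟦ + 16 ⟧ * κ₂
        ≈⟨ solve 4 (λ a z k l → a :+ con (+ 16) :* k :- con (+ 8) :* z :- con (+ 16) :* l
             := a :- con (+ 8) :* z :+ con (+ 16) :* (k :- l)) refl _ z κ₁ κ₂ ⟩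
      𝓔 + 𝟚 * (O * W * T²) + ⟦ + 8 ⟧ * (β * g₁) - ⟦ + 8 ⟧ * z + ⟦ + 16 ⟧ * (κ₁ - κ₂) ∎)
      where
      S² = (𝟙 + 𝟚 * g) * (𝟙 + 𝟚 * g)
      quartic : Carrier → Carrier
      quartic x = x * x + 𝟚 * (x * x * x) + x * x * x * x
      fourth-power : ∀ x → (𝟙 + 𝟚 * x) * (𝟙 + 𝟚 * x) * ((𝟙 + 𝟚 * x) * (𝟙 + 𝟚 * x))
        ≈ 𝟙 + ⟦ + 8 ⟧ * (x + x * x) + ⟦ + 16 ⟧ * quartic x
      fourth-power = solve 1 (λ x →
        (con (+ 1) :+ con (+ 2) :* x) :* (con (+ 1) :+ con (+ 2) :* x)
          :* ((con (+ 1) :+ con (+ 2) :* x) :* (con (+ 1) :+ con (+ 2) :* x))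
        := con (+ 1) :+ con (+ 8) :* (x :+ x :* x)
          :+ con (+ 16) :* (x :* x :+ con (+ 2) :* (x :* x :* x) :+ x :* x :* x :* x)) refl
      s = g + g * g ; s′ = quartic g ; t = h + h * h ; t′ = quartic h
      w = s′ + t′ + ⟦ + 4 ⟧ * (s * t) + ⟦ + 8 ⟧ * (s * t′) + ⟦ + 8 ⟧ * (s′ * t) + ⟦ + 16 ⟧ * (s′ * t′)
      κ₂ = w + f * z + 𝟚 * (f * w)
      left : F * (S² * T²) * (S² * T²) ≈ F + ⟦ + 8 ⟧ * z + ⟦ + 16 ⟧ * κ₂
      left = begin
        F * (S² * T²) * (S² * T²)
          ≈⟨ solve 3 (λ F S T → F :* (S :* T) :* (S :* T) := F :* (S :* S :* (T :* T))) refl F S² T² ⟩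
        F * (S² * S² * (T² * T²))
          ≈⟨ *-congˡ (*-cong (fourth-power g) (fourth-power h)) ⟩
        F * ((𝟙 + ⟦ + 8 ⟧ * s + ⟦ + 16 ⟧ * s′) * (𝟙 + ⟦ + 8 ⟧ * t + ⟦ + 16 ⟧ * t′))
          ≈⟨ *-congˡ (solve 4 (λ s s′ t t′ →
               (con (+ 1) :+ con (+ 8) :* s :+ con (+ 16) :* s′) :* (con (+ 1) :+ con (+ 8) :* t :+ con (+ 16) :* t′)
               := con (+ 1) :+ con (+ 8) :* (s :+ t) :+ con (+ 16) :* (s′ :+ t′ :+ con (+ 4) :* (s :* t)
                  :+ con (+ 8) :* (s :* t′) :+ con (+ 8) :* (s′ :* t) :+ con (+ 16) :* (s′ :* t′)))
               refl s s′ t t′) ⟩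
        F * (𝟙 + ⟦ + 8 ⟧ * z + ⟦ + 16 ⟧ * w)
          -- F = 1 + 2f replaces 8zF by 8z at the cost of 16fz.
          ≈⟨ *-congʳ F≈ ⟩
        (𝟙 + 𝟚 * f) * (𝟙 + ⟦ + 8 ⟧ * z + ⟦ + 16 ⟧ * w)
          ≈⟨ solve 3 (λ f z w → (con (+ 1) :+ con (+ 2) :* f) :* (con (+ 1) :+ con (+ 8) :* z :+ con (+ 16) :* w)
               := con (+ 1) :+ con (+ 2) :* f :+ con (+ 8) :* z
                  :+ con (+ 16) :* (w :+ f :* z :+ con (+ 2) :* (f :* w))) refl f z w ⟩
        𝟙 + 𝟚 * f + ⟦ + 8 ⟧ * z + ⟦ + 16 ⟧ * κ₂
          ≈⟨ +-congʳ (+-congʳ F≈) ⟨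
        F + ⟦ + 8 ⟧ * z + ⟦ + 16 ⟧ * κ₂ ∎
      t₂ = 𝟚 * (h + h * h)
      o = β * ε - δ * γ
      r = k * (g₁ * g₁) + g₀ * g₁ + k * g₁ + 𝟚 * (k * g₀ * g₁)
      κ₁ = O * r * T² + β * g₁ * t₂ + o * g₁ + 𝟚 * (o * g₁ * t₂)
      -- Outside `W`, 4g₁ is all that remains modulo 8: the mixed products g₀g₁, kg₁, kg₁² and kg₀g₁
      -- carry a factor 8, which becomes 16 with the factor 2 in front of `O`.
      VS² : (𝟙 + 𝟚 * k) * S² ≈ W + ⟦ + 4 ⟧ * g₁ + ⟦ + 8 ⟧ * r
      VS² = solve 3 (λ k g₁ g₀ →
        (con (+ 1) :+ con (+ 2) :* k) :* ((con (+ 1) :+ con (+ 2) :* (g₁ :+ g₀)) :* (con (+ 1) :+ con (+ 2) :* (g₁ :+ g₀)))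
        := con (+ 1) :+ con (+ 4) :* (g₀ :+ g₀ :* g₀ :+ g₁ :* g₁)
             :+ con (+ 2) :* (k :* (con (+ 1) :+ con (+ 4) :* (g₀ :+ g₀ :* g₀)))
           :+ con (+ 4) :* g₁
           :+ con (+ 8) :* (k :* (g₁ :* g₁) :+ g₀ :* g₁ :+ k :* g₁ :+ con (+ 2) :* (k :* g₀ :* g₁)))
        refl k g₁ g₀
      -- In front of the factor 8 it suffices that O ≡ β and T² ≡ 1 modulo 2.
      mixed : ⟦ + 8 ⟧ * (O * g₁ * T²) ≈ ⟦ + 8 ⟧ * (β * g₁)
                + ⟦ + 16 ⟧ * (β * g₁ * t₂ + o * g₁ + 𝟚 * (o * g₁ * t₂))
      mixed = begin
        ⟦ + 8 ⟧ * (O * g₁ * T²)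
          ≈⟨ *-congˡ (*-cong (*-congʳ (solve 4 (λ β δ γ ε →
               β :* (con (+ 1) :+ con (+ 2) :* ε) :- con (+ 2) :* (δ :* γ)
               := β :+ con (+ 2) :* (β :* ε :- δ :* γ)) refl β δ γ ε))
               (solve 1 (λ h → (con (+ 1) :+ con (+ 2) :* h) :* (con (+ 1) :+ con (+ 2) :* h)
                 := con (+ 1) :+ con (+ 2) :* (con (+ 2) :* (h :+ h :* h))) refl h)) ⟩
        ⟦ + 8 ⟧ * ((β + 𝟚 * o) * g₁ * (𝟙 + 𝟚 * t₂))
          ≈⟨ solve 4 (λ β o g t → con (+ 8) :* ((β :+ con (+ 2) :* o) :* g :* (con (+ 1) :+ con (+ 2) :* t))
               := con (+ 8) :* (β :* g) :+ con (+ 16) :* (β :* g :* t :+ o :* g :+ con (+ 2) :* (o :* g :* t)))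
               refl β o g₁ t₂ ⟩
        ⟦ + 8 ⟧ * (β * g₁) + ⟦ + 16 ⟧ * (β * g₁ * t₂ + o * g₁ + 𝟚 * (o * g₁ * t₂)) ∎
      right : (𝟙 + 𝟚 * (β + δ + γ + ε)) * (𝟙 + 𝟚 * (ε - γ)) * ((𝟙 + 𝟚 * c) * (𝟙 + 𝟚 * d)) * (S² * T²)
        ≈ 𝓔 + 𝟚 * (O * W * T²) + ⟦ + 8 ⟧ * (β * g₁) + ⟦ + 16 ⟧ * κ₁
      right = begin
        (𝟙 + 𝟚 * (β + δ + γ + ε)) * (𝟙 + 𝟚 * (ε - γ)) * ((𝟙 + 𝟚 * c) * (𝟙 + 𝟚 * d)) * (S² * T²)
          ≈⟨ *-congʳ (*-cong
               (solve 4 (λ β δ γ ε →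
                 (con (+ 1) :+ con (+ 2) :* (β :+ δ :+ γ :+ ε)) :* (con (+ 1) :+ con (+ 2) :* (ε :- γ))
                 := (con (+ 1) :+ con (+ 2) :* ε) :* (con (+ 1) :+ con (+ 2) :* ε)
                    :+ con (+ 2) :* (δ :* (con (+ 1) :+ con (+ 2) :* ε)) :- con (+ 4) :* (β :* γ :+ γ :* γ)
                    :+ con (+ 2) :* (β :* (con (+ 1) :+ con (+ 2) :* ε) :- con (+ 2) :* (δ :* γ)))
                 refl β δ γ ε)
               (solve 2 (λ c d → (con (+ 1) :+ con (+ 2) :* c) :* (con (+ 1) :+ con (+ 2) :* d)
                 := con (+ 1) :+ con (+ 2) :* (c :+ d :+ con (+ 2) :* (c :* d))) refl c d)) ⟩
        (E + 𝟚 * O) * (𝟙 + 𝟚 * k) * (S² * T²)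
          ≈⟨ solve 5 (λ E O V S T → (E :+ con (+ 2) :* O) :* V :* (S :* T)
               := E :* (V :* S :* T) :+ con (+ 2) :* (O :* (V :* S) :* T)) refl E O (𝟙 + 𝟚 * k) S² T² ⟩
        𝓔 + 𝟚 * (O * ((𝟙 + 𝟚 * k) * S²) * T²)
          ≈⟨ +-congˡ (*-congˡ (*-congʳ (*-congˡ VS²))) ⟩
        𝓔 + 𝟚 * (O * (W + ⟦ + 4 ⟧ * g₁ + ⟦ + 8 ⟧ * r) * T²)
          ≈⟨ solve 6 (λ 𝓔 O W g r T → 𝓔 :+ con (+ 2) :* (O :* (W :+ con (+ 4) :* g :+ con (+ 8) :* r) :* T)
               := 𝓔 :+ con (+ 2) :* (O :* W :* T) :+ con (+ 8) :* (O :* g :* T) :+ con (+ 16) :* (O :* r :* T))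
               refl 𝓔 O W g₁ r T² ⟩
        𝓔 + 𝟚 * (O * W * T²) + ⟦ + 8 ⟧ * (O * g₁ * T²) + ⟦ + 16 ⟧ * (O * r * T²)
          ≈⟨ +-congʳ (+-congˡ mixed) ⟩
        𝓔 + 𝟚 * (O * W * T²) + (⟦ + 8 ⟧ * (β * g₁) + ⟦ + 16 ⟧ * (β * g₁ * t₂ + o * g₁ + 𝟚 * (o * g₁ * t₂)))
          + ⟦ + 16 ⟧ * (O * r * T²)
          ≈⟨ solve 6 (λ a b x y p q → a :+ (b :+ con (+ 16) :* (x :+ y :+ p)) :+ con (+ 16) :* q
               := a :+ b :+ con (+ 16) :* (q :+ x :+ y :+ p)) refl _ _ _ _ _ _ ⟩
        𝓔 + 𝟚 * (O * W * T²) + ⟦ + 8 ⟧ * (β * g₁) + ⟦ + 16 ⟧ * κ₁ ∎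

  half-θ half-θ-neg : Carrier → ℕ → Carrier
  half-θ     y n = ∑ n (λ s → sign (suc s) * square-^ y (suc s))
  half-θ-neg y n = ∑ n (λ s → square-^ y (suc s))

  module QuotientExpansion (q : Carrier) (L : ℕ) where
    open Dissection q L public
    open Expansion β δ γ ε g₁ g₀ (half-θ-neg (q ^ 2) L) (half-θ-neg (q ^ 18) L) (half-θ (q ^ 36) L) public

    -- The theta series are cut at 6L, 2L, 3L or L according to their dissections; `θ-stable` brings
    -- all of them to the common cut-off M of `quotient-θ`.
    quotient-expansion : ∀ {M F f J} → Nilpotent M q → M ℕ.≤ J → M ℕ.≤ L →
      F * oddProduct M (q ^ 9) J ≈ oddProduct M q J → F ≈ 𝟙 + 𝟚 * f →
      ∃ λ κ → F ≈ 𝓔 + 𝟚 * (O * W * T²) + ⟦ + 8 ⟧ * (β * g₁) - ⟦ + 8 ⟧ * z + ⟦ + 16 ⟧ * κ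
    quotient-expansion {M} {F} nil M≤J M≤L eq F≈ = expansion F≈ (begin
      F * ((𝟙 + 𝟚 * g) * (𝟙 + 𝟚 * g) * T²)
        ≈⟨ *-congˡ (*-cong (*-cong θ₄ θ₄) (*-cong θ₃₆ θ₃₆)) ⟨
      F * (θ (q ^ 4) M * θ (q ^ 4) M * (θ (q ^ 36) M * θ (q ^ 36) M))
        ≈⟨ quotient-θ M nil M≤J eq ⟩
      θ (- q) M * θ (q ^ 9) M * (θ (- (q ^ 2)) M * θ (- (q ^ 18)) M)
        ≈⟨ *-cong (*-cong (stabilise (nilpotent-neg M nil) (M≤L* 5) θ-neg-dissection)
                          (stabilise (nilpotent-^ M nil 8) (M≤L* 1) θ-nine-dissection))
                  (*-cong (stabilise (nilpotent-neg M (nilpotent-^ M nil 1)) M≤L (θ-neg-∑ (q ^ 2) L))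
                          (stabilise (nilpotent-neg M (nilpotent-^ M nil 17)) M≤L (θ-neg-∑ (q ^ 18) L))) ⟩
      (𝟙 + 𝟚 * (β + δ + γ + ε)) * (𝟙 + 𝟚 * (ε - γ))
        * ((𝟙 + 𝟚 * half-θ-neg (q ^ 2) L) * (𝟙 + 𝟚 * half-θ-neg (q ^ 18) L)) ∎)
      where
      M≤L* : ∀ k → M ℕ.≤ L ℕ.* suc k
      M≤L* k = ℕₚ.≤-trans M≤L (ℕₚ.m≤m*n L (suc k))
      stabilise : ∀ {y n x} → Nilpotent M y → M ℕ.≤ n → θ y n ≈ x → θ y M ≈ x
      stabilise nil M≤n e = trans (sym (θ-stable M nil M≤n)) e
      θ₄ : θ (q ^ 4) M ≈ 𝟙 + 𝟚 * g
      θ₄ = stabilise (nilpotent-^ M nil 3) (M≤L* 2) θ-four-dissection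
      θ₃₆ : θ (q ^ 36) M ≈ 𝟙 + 𝟚 * half-θ (q ^ 36) L
      θ₃₆ = stabilise (nilpotent-^ M nil 35) M≤L (θ-∑ (q ^ 36) L)

open ≡ using (refl; sym; trans; cong; cong₂; subst)

-- Sums of two squares and the index

SumOfTwoSquares : ℕ → Set
SumOfTwoSquares n = ∃₂ λ x y → n ≡ x ℕ.* x ℕ.+ y ℕ.* y

module _ {p} (pp : Prime p) (legendre : LegendreMinusOne (ℤ.- (+ 9)) p) where
  open import Data.Nat using (_+_; _*_; _^_)
  open ℕ∣ using (_∣_; _∤_)

  private instance
    _ = prime⇒nonZero pp

  ∤-square+9 : ∀ z → p ∤ z * z + 9
  ∤-square+9 z p∣ = proj₂ legendre (+ z , subst (λ x → p ∣ ℤ.∣ x ℤ.+ + 9 ∣) (ℤₚ.pos-* z z) p∣)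

  ∤⇒coprime : ∀ {y} → p ∤ y → Coprime p y
  ∤⇒coprime p∤y (d∣p , d∣y) with prime⇒irreducible pp d∣p
  ... | inj₁ d≡1  = d≡1
  ... | inj₂ refl = ⊥-elim (p∤y d∣y)

  -- If y is invertible mod p with inverse ±w, then (3xw)² ≡ -9.
  ∣squares⇒∣ʳ : ∀ x y → p ∣ x * x + y * y → p ∣ y
  ∣squares⇒∣ʳ x y (divides s eq) with p ℕ∣.∣? y
  ... | yes p∣y = p∣y
  ... | no  p∤y with coprime-Bézout (∤⇒coprime p∤y)
  ...   | Bézout.+- k w e = ⊥-elim (∤-square+9 (3 * x * w) (∣m+n∣m⇒∣n
            (divides (9 * w * w * s + 18 * k) (begin
              9 * k * k * p * p + (3 * x * w * (3 * x * w) + 9)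
                ≡⟨ ℕSolver.solve 4 (λ x w k p → con 9 :* k :* k :* p :* p :+ (con 3 :* x :* w :* (con 3 :* x :* w) :+ con 9)
                     := con 9 :* ((k :* p) :* (k :* p)) :+ con 9 :* w :* w :* (x :* x) :+ con 9) refl x w k p ⟩
              9 * (k * p * (k * p)) + 9 * w * w * (x * x) + 9
                ≡⟨ cong (λ t → 9 * (t * t) + 9 * w * w * (x * x) + 9) e ⟨
              9 * ((1 + w * y) * (1 + w * y)) + 9 * w * w * (x * x) + 9
                ≡⟨ ℕSolver.solve 3 (λ x w y → con 9 :* ((con 1 :+ w :* y) :* (con 1 :+ w :* y)) :+ con 9 :* w :* w :* (x :* x) :+ con 9
                     := con 9 :* w :* w :* (x :* x :+ y :* y) :+ con 18 :* (con 1 :+ w :* y)) refl x w y ⟩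
              9 * w * w * (x * x + y * y) + 18 * (1 + w * y)
                ≡⟨ cong₂ (λ a b → 9 * w * w * a + 18 * b) eq e ⟩
              9 * w * w * (s * p) + 18 * (k * p)
                ≡⟨ ℕSolver.solve 4 (λ w s k p → con 9 :* w :* w :* (s :* p) :+ con 18 :* (k :* p)
                     := (con 9 :* w :* w :* s :+ con 18 :* k) :* p) refl w s k p ⟩
              (9 * w * w * s + 18 * k) * p ∎))
            (divides (9 * k * k * p) refl)))
    where
    open ≡.≡-Reasoning
    open ℕSolver using (con; _:+_; _:*_; _:=_)
  ...   | Bézout.-+ k w e = ⊥-elim (∤-square+9 (3 * x * w) (∣m+n∣m⇒∣n
            (divides (9 * w * w * s) (begin
              9 * k * (2 + k * p) * p + (3 * x * w * (3 * x * w) + 9)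
                ≡⟨ ℕSolver.solve 4 (λ x w k p → con 9 :* k :* (con 2 :+ k :* p) :* p :+ (con 3 :* x :* w :* (con 3 :* x :* w) :+ con 9)
                     := con 9 :* ((con 1 :+ k :* p) :* (con 1 :+ k :* p)) :+ con 9 :* w :* w :* (x :* x)) refl x w k p ⟩
              9 * ((1 + k * p) * (1 + k * p)) + 9 * w * w * (x * x)
                ≡⟨ cong (λ t → 9 * (t * t) + 9 * w * w * (x * x)) e ⟩
              9 * (w * y * (w * y)) + 9 * w * w * (x * x)
                ≡⟨ ℕSolver.solve 3 (λ x w y → con 9 :* (w :* y :* (w :* y)) :+ con 9 :* w :* w :* (x :* x)
                     := con 9 :* w :* w :* (x :* x :+ y :* y)) refl x w y ⟩
              9 * w * w * (x * x + y * y)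
                ≡⟨ cong (9 * w * w *_) eq ⟩
              9 * w * w * (s * p)
                ≡⟨ ℕₚ.*-assoc (9 * w * w) s p ⟨
              9 * w * w * s * p ∎))
            (divides (9 * k * (2 + k * p)) refl)))
    where
    open ≡.≡-Reasoning
    open ℕSolver using (con; _:+_; _:*_; _:=_)

  -- Descent: p divides both x and y, so p² can be cancelled and α drops by one. For α = 0 only one
  -- factor p is available on the left, and the second must divide c.
  odd-valuation⇒¬sumOfTwoSquares : ∀ α {c} → p ∤ c → ¬ SumOfTwoSquares (p ^ (1 + α * 2) * c)
  odd-valuation⇒¬sumOfTwoSquares α {c} p∤c (x , y , eq)
    with ∣squares⇒∣ʳ x y p∣xy | ∣squares⇒∣ʳ y x (subst (p ∣_) (ℕₚ.+-comm (x * x) (y * y)) p∣xy)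
    where
    p∣xy : p ∣ x * x + y * y
    p∣xy = subst (p ∣_) eq (divides (p ^ (α * 2) * c)
      (trans (ℕₚ.*-assoc p _ c) (ℕₚ.*-comm p _)))
  ... | divides v refl | divides u refl = descend α (ℕₚ.*-cancelˡ-≡ _ _ p (trans (sym (ℕₚ.*-assoc p _ c))
      (trans eq (ℕSolver.solve 3 (λ u v p → (u :* p) :* (u :* p) :+ (v :* p) :* (v :* p)
        := p :* (p :* (u :* u :+ v :* v))) refl u v p))))
    where
    open ℕSolver using (con; _:+_; _:*_; _:=_)
    descend : ∀ α → p ^ (α * 2) * c ≢ p * (u * u + v * v)
    descend zero e = p∤c (divides (u * u + v * v) (trans (sym (ℕₚ.*-identityˡ c)) (trans e (ℕₚ.*-comm p _))))
    descend (suc α) e = odd-valuation⇒¬sumOfTwoSquares α p∤c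
      (u , v , ℕₚ.*-cancelˡ-≡ _ _ p (trans (sym (ℕₚ.*-assoc p _ c)) e))

module _ {p} (pp : Prime p) (5≤p : 5 ℕ.≤ p) where
  open import Data.Nat using (_+_; _*_; _^_; _≤_; _<_; _∸_)
  open ℕ∣ using (_∣_; _∤_)

  ∤12 : p ∤ 12
  ∤12 p∣12 with euclidsLemma 4 3 pp p∣12
  ... | inj₁ p∣4 = ℕₚ.<⇒≱ 5≤p (∣⇒≤ p∣4)
  ... | inj₂ p∣3 = ℕₚ.<⇒≱ (ℕₚ.≤-trans (ℕₚ.n≤1+n 4) 5≤p) (∣⇒≤ p∣3)

  cofactor-split : ∀ n i → 12 * (p * n + i) + 5 * p ≡ (12 * n + 5) * p + 12 * i
  cofactor-split n i = ℕSolver.solve 3 (λ n i p → con 12 :* (p :* n :+ i) :+ con 5 :* p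
    := (con 12 :* n :+ con 5) :* p :+ con 12 :* i) refl n i p
    where open ℕSolver using (con; _:+_; _:*_; _:=_)

  -- Modulo p only 12i is left, and neither 12 nor i with 0 < i < p is divisible by p.
  index-cofactor : ∀ n {i} → 1 ≤ i → i ≤ p ∸ 1 → p ∤ 12 * (p * n + i) + 5 * p
  index-cofactor n {i} 1≤i i≤p-1 p∣ =
    [ ∤12 , >⇒∤ {{ℕ.>-nonZero 1≤i}} i<p ]′ (euclidsLemma 12 i pp
      (∣m+n∣m⇒∣n (subst (p ∣_) (cofactor-split n i) p∣) (divides (12 * n + 5) refl)))
    where
    i<p : i < p
    i<p = ℕₚ.≤-trans (s≤s i≤p-1) (ℕₚ.≤-reflexive (ℕₚ.m+[n∸m]≡n (ℕₚ.≤-trans (s≤s z≤n) 5≤p)))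

  private
    ∤-small : ∀ d → 1 < d → d < 5 → d ∤ p
    ∤-small d 1<d d<5 d∣p with prime⇒irreducible pp d∣p
    ... | inj₁ refl = ℕₚ.<-irrefl refl 1<d
    ... | inj₂ refl = ℕₚ.<⇒≱ d<5 5≤p

  square%2 : (p * p) % 2 ≡ 1
  square%2 = trans (%-distribˡ-* p p 2) (residue (p % 2) refl (m%n<n p 2))
    where
    residue : ∀ r → p % 2 ≡ r → r < 2 → (r * r) % 2 ≡ 1
    residue 0 eq _ = ⊥-elim (∤-small 2 (s≤s (s≤s z≤n)) (s≤s (s≤s (s≤s z≤n))) (m%n≡0⇒n∣m p 2 eq))
    residue 1 _  _ = refl
    residue (suc (suc _)) _ (s≤s (s≤s ()))

  square%3 : (p * p) % 3 ≡ 1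
  square%3 = trans (%-distribˡ-* p p 3) (residue (p % 3) refl (m%n<n p 3))
    where
    residue : ∀ r → p % 3 ≡ r → r < 3 → (r * r) % 3 ≡ 1
    residue 0 eq _ = ⊥-elim (∤-small 3 (s≤s (s≤s z≤n)) (s≤s (s≤s (s≤s (s≤s z≤n)))) (m%n≡0⇒n∣m p 3 eq))
    residue 1 _  _ = refl
    residue 2 _  _ = refl
    residue (suc (suc (suc _))) _ (s≤s (s≤s (s≤s ())))

power%≡1 : ∀ d .{{_ : ℕ.NonZero d}} b → b % d ≡ 1 % d → ∀ k → (b ℕ.^ k) % d ≡ 1 % d
power%≡1 d b e zero    = refl
power%≡1 d b e (suc k) = trans (%-distribˡ-* b (b ℕ.^ k) d)
  (trans (cong₂ (λ x y → (x ℕ.* y) % d) e (power%≡1 d b e k)) (sym (%-distribˡ-* 1 1 d)))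

module _ (p α n i : ℕ) where
  open import Data.Nat using (_+_; _*_; _^_)
  open ℕSolver using (con; _:+_; _:*_; _:=_)

  index : ℕ
  index = 12 * p ^ (2 * α + 2) * n + (12 * i + 5 * p) * p ^ (2 * α + 1)

  private
    odd-power : p ^ (2 * α + 1) ≡ p * p ^ (α * 2)
    odd-power = cong (p ^_) (ℕSolver.solve 1 (λ α → con 2 :* α :+ con 1 := con 1 :+ α :* con 2) refl α)
    even-power : p ^ (2 * α + 2) ≡ p * (p * p ^ (α * 2))
    even-power = cong (p ^_) (ℕSolver.solve 1 (λ α → con 2 :* α :+ con 2 := con 2 :+ α :* con 2) refl α)
    square-power : p ^ (α * 2) ≡ (p * p) ^ α
    square-power = trans (cong (p ^_) (ℕₚ.*-comm α 2)) (trans (sym (ℕₚ.^-*-assoc p 2 α))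
      (cong (λ b → (p * b) ^ α) (ℕₚ.*-identityʳ p)))

  index-factored : index ≡ p ^ (1 + α * 2) * (12 * (p * n + i) + 5 * p)
  index-factored = trans (cong₂ (λ a b → 12 * a * n + (12 * i + 5 * p) * b) even-power odd-power)
    (ℕSolver.solve 4 (λ p n i P → con 12 :* (p :* (p :* P)) :* n :+ (con 12 :* i :+ con 5 :* p) :* (p :* P)
      := p :* P :* (con 12 :* (p :* n :+ i) :+ con 5 :* p)) refl p n i (p ^ (α * 2)))

  -- The part 5p · p^(2α+1) is 5 times a power of p², and p² is 1 modulo 2 and modulo 3; the rest is
  -- a multiple of 12.
  index%12 : ∃ λ K → index ≡ 5 * (p * p) ^ suc α + K * 12
  index%12 = p * P * (p * n + i) , (begin
    index ≡⟨ index-factored ⟩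
    p * P * (12 * (p * n + i) + 5 * p)
      ≡⟨ ℕSolver.solve 4 (λ p n i P → p :* P :* (con 12 :* (p :* n :+ i) :+ con 5 :* p)
           := con 5 :* (p :* p :* P) :+ p :* P :* (p :* n :+ i) :* con 12) refl p n i P ⟩
    5 * (p * p * P) + p * P * (p * n + i) * 12
      ≡⟨ cong (λ t → 5 * (p * p * t) + p * P * (p * n + i) * 12) square-power ⟩
    5 * (p * p) ^ suc α + p * P * (p * n + i) * 12 ∎)
    where
    open ≡.≡-Reasoning
    P = p ^ (α * 2)

  -- For d = 2 and d = 3 this yields that the index is ≡ 5 (mod 6).
  index% : ∀ d e .{{_ : ℕ.NonZero d}} → e * d ≡ 12 → (p * p) % d ≡ 1 % d → index % d ≡ 5 % d
  index% d e e*d≡12 p²%d = begin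
    index % d                                ≡⟨ cong (_% d) eq ⟩
    (5 * (p * p) ^ suc α + K * 12) % d       ≡⟨ cong (λ t → (5 * (p * p) ^ suc α + t) % d)
                                                  (trans (ℕₚ.*-assoc K e d) (cong (K *_) e*d≡12)) ⟨
    (5 * (p * p) ^ suc α + K * e * d) % d    ≡⟨ [m+kn]%n≡m%n (5 * (p * p) ^ suc α) (K * e) d ⟩
    (5 * (p * p) ^ suc α) % d                ≡⟨ %-distribˡ-* 5 _ d ⟩
    (5 % d * ((p * p) ^ suc α % d)) % d      ≡⟨ cong (λ t → (5 % d * t) % d) (power%≡1 d (p * p) p²%d (suc α)) ⟩
    (5 % d * (1 % d)) % d                    ≡⟨ %-distribˡ-* 5 1 d ⟨
    5 % d ∎
    where
    open ≡.≡-Reasoning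
    K = proj₁ index%12
    eq = proj₂ index%12

open ℤSolver.+-*-Solver using (_:=_; _:+_; _:*_) renaming (solve to solveℤ)

-- The ring of power series truncated after q^N

tail : Series → Series
tail f n = f (suc n)

scalar : ℤ → Series
scalar z zero    = z
scalar z (suc _) = + 0

addS : Series → Series → Series
addS f g n = f n ℤ.+ g n

negS : Series → Series
negS f n = ℤ.- f n

mulS-zero : ∀ f g → mulS f g 0 ≡ f 0 ℤ.* g 0
mulS-zero f g = ℤₚ.+-identityʳ _

-- From f = f(0) + q · `tail f`. This recursion replaces the convolution list, so that the ring laws
-- follow by induction on the exponent.
mulS-suc : ∀ f g n → mulS f g (suc n) ≡ f 0 ℤ.* g (suc n) ℤ.+ mulS (tail f) g n
mulS-suc f g n = cong (λ l → f 0 ℤ.* g (suc n) ℤ.+ sumℤ l)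
  (trans (map-applyUpTo suc (λ k → f k ℤ.* g (suc n ℕ.∸ k)) (suc n))
         (sym (map-applyUpTo id (λ k → tail f k ℤ.* g (n ℕ.∸ k)) (suc n))))

-- The bound k ≤ n is what makes multiplication compatible with truncation.
mulS-cong : ∀ {f f′ g g′} n → (∀ {k} → k ℕ.≤ n → f k ≡ f′ k) → (∀ {k} → k ℕ.≤ n → g k ≡ g′ k) →
            mulS f g n ≡ mulS f′ g′ n
mulS-cong {f} {f′} {g} {g′} zero p q =
  trans (mulS-zero f g) (trans (cong₂ ℤ._*_ (p z≤n) (q z≤n)) (sym (mulS-zero f′ g′)))
mulS-cong {f} {f′} {g} {g′} (suc n) p q =
  trans (mulS-suc f g n)
  (trans (cong₂ ℤ._+_ (cong₂ ℤ._*_ (p z≤n) (q ℕₚ.≤-refl))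
                      (mulS-cong n (p ∘ s≤s) (q ∘ ℕₚ.m≤n⇒m≤1+n)))
         (sym (mulS-suc f′ g′ n)))

mulS-distribʳ : ∀ h f g n → mulS (addS f g) h n ≡ mulS f h n ℤ.+ mulS g h n
mulS-distribʳ h f g zero
  rewrite mulS-zero (addS f g) h | mulS-zero f h | mulS-zero g h = ℤₚ.*-distribʳ-+ (h 0) (f 0) (g 0)
mulS-distribʳ h f g (suc n)
  rewrite mulS-suc (addS f g) h n | mulS-suc f h n | mulS-suc g h n
        | mulS-distribʳ h (tail f) (tail g) n =
  solveℤ 5 (λ a b c x y → (a :+ b) :* c :+ (x :+ y) := a :* c :+ x :+ (b :* c :+ y)) refl
    (f 0) (g 0) (h (suc n)) _ _

-- The mirror image of `mulS-suc`; commutativity comes from comparing the two.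
mulS-sucʳ : ∀ f g n → mulS f g (suc n) ≡ mulS f (tail g) n ℤ.+ f (suc n) ℤ.* g 0
mulS-sucʳ f g zero
  rewrite mulS-suc f g 0 | mulS-zero (tail f) g | mulS-zero f (tail g) = refl
mulS-sucʳ f g (suc n)
  rewrite mulS-suc f g (suc n) | mulS-sucʳ (tail f) g n | mulS-suc f (tail g) n =
  sym (ℤₚ.+-assoc (f 0 ℤ.* g (suc (suc n))) _ _)

mulS-comm : ∀ f g n → mulS f g n ≡ mulS g f n
mulS-comm f g zero rewrite mulS-zero f g | mulS-zero g f = ℤₚ.*-comm (f 0) (g 0)
mulS-comm f g (suc n)
  rewrite mulS-suc f g n | mulS-sucʳ g f n | mulS-comm (tail f) g n | ℤₚ.*-comm (f 0) (g (suc n)) =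
  ℤₚ.+-comm (g (suc n) ℤ.* f 0) _

mulS-scaleˡ : ∀ z f g n → mulS (λ k → z ℤ.* f k) g n ≡ z ℤ.* mulS f g n
mulS-scaleˡ z f g zero
  rewrite mulS-zero (λ k → z ℤ.* f k) g | mulS-zero f g = ℤₚ.*-assoc z (f 0) (g 0)
mulS-scaleˡ z f g (suc n)
  rewrite mulS-suc (λ k → z ℤ.* f k) g n | mulS-suc f g n | mulS-scaleˡ z (tail f) g n =
  solveℤ 4 (λ z a b x → z :* a :* b :+ z :* x := z :* (a :* b :+ x)) refl z (f 0) (g (suc n)) _

mulS-assoc : ∀ f g h n → mulS (mulS f g) h n ≡ mulS f (mulS g h) n
mulS-assoc f g h zero
  rewrite mulS-zero (mulS f g) h | mulS-zero f g | mulS-zero f (mulS g h) | mulS-zero g h =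
  ℤₚ.*-assoc (f 0) (g 0) (h 0)
mulS-assoc f g h (suc n) = begin
  mulS (mulS f g) h (suc n)
    ≡⟨ mulS-suc (mulS f g) h n ⟩
  mulS f g 0 ℤ.* h (suc n) ℤ.+ mulS (tail (mulS f g)) h n
    -- The tail of a product is f(0) · `tail g` + `tail f` · g, again by `mulS-suc`.
    ≡⟨ cong₂ (λ x y → x ℤ.* h (suc n) ℤ.+ y) (mulS-zero f g)
         (mulS-cong {g = h} n (λ {k} _ → mulS-suc f g k) (λ _ → refl)) ⟩
  f 0 ℤ.* g 0 ℤ.* h (suc n) ℤ.+ mulS (addS (λ k → f 0 ℤ.* tail g k) (mulS (tail f) g)) h n
    ≡⟨ cong (λ y → f 0 ℤ.* g 0 ℤ.* h (suc n) ℤ.+ y) (mulS-distribʳ h (λ k → f 0 ℤ.* tail g k) (mulS (tail f) g) n) ⟩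
  f 0 ℤ.* g 0 ℤ.* h (suc n) ℤ.+ (mulS (λ k → f 0 ℤ.* tail g k) h n ℤ.+ mulS (mulS (tail f) g) h n)
    ≡⟨ cong₂ (λ x y → f 0 ℤ.* g 0 ℤ.* h (suc n) ℤ.+ (x ℤ.+ y))
         (mulS-scaleˡ (f 0) (tail g) h n) (mulS-assoc (tail f) g h n) ⟩
  f 0 ℤ.* g 0 ℤ.* h (suc n) ℤ.+ (f 0 ℤ.* mulS (tail g) h n ℤ.+ mulS (tail f) (mulS g h) n)
    ≡⟨ solveℤ 5 (λ a b c x y → a :* b :* c :+ (a :* x :+ y) := a :* (b :* c :+ x) :+ y) refl
         (f 0) (g 0) (h (suc n)) _ _ ⟩
  f 0 ℤ.* (g 0 ℤ.* h (suc n) ℤ.+ mulS (tail g) h n) ℤ.+ mulS (tail f) (mulS g h) n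
    ≡⟨ cong (λ x → f 0 ℤ.* x ℤ.+ mulS (tail f) (mulS g h) n) (mulS-suc g h n) ⟨
  f 0 ℤ.* mulS g h (suc n) ℤ.+ mulS (tail f) (mulS g h) n
    ≡⟨ mulS-suc f (mulS g h) n ⟨
  mulS f (mulS g h) (suc n) ∎
  where open ≡.≡-Reasoning

mulS-zeroˡ : ∀ g n → mulS (λ _ → + 0) g n ≡ + 0
mulS-zeroˡ g zero    = mulS-zero (λ _ → + 0) g
mulS-zeroˡ g (suc n) rewrite mulS-suc (λ _ → + 0) g n | mulS-zeroˡ g n = refl

mulS-scalar : ∀ z g n → mulS (scalar z) g n ≡ z ℤ.* g n
mulS-scalar z g zero    = mulS-zero (scalar z) g
mulS-scalar z g (suc n) rewrite mulS-suc (scalar z) g n | mulS-zeroˡ g n = ℤₚ.+-identityʳ _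

mulS-negˡ : ∀ f g n → mulS (negS f) g n ≡ ℤ.- mulS f g n
mulS-negˡ f g n = trans (mulS-cong {g = g} n (λ {k} _ → sym (ℤₚ.-1*i≡-i (f k))) (λ _ → refl))
  (trans (mulS-scaleˡ (ℤ.- + 1) f g n) (ℤₚ.-1*i≡-i (mulS f g n)))

one≗scalar : ∀ n → one n ≡ scalar (+ 1) n
one≗scalar zero    = refl
one≗scalar (suc _) = refl

mulS-identityˡ : ∀ g n → mulS one g n ≡ g n
mulS-identityˡ g n = trans (mulS-cong {g = g} n (λ {k} _ → one≗scalar k) (λ _ → refl))
  (trans (mulS-scalar (+ 1) g n) (ℤₚ.*-identityˡ (g n)))

module _ (N : ℕ) where

  -- A record, so that f and g can be inferred from the type f ≈ₙ g.
  infix 4 _≈ₙ_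
  record _≈ₙ_ (f g : Series) : Set where
    constructor pointwise
    field coefficient : ∀ n → n ℕ.≤ N → f n ≡ g n

  open _≈ₙ_ public

  -- Only the equality is truncated: the elements remain full series multiplied by `mulS`, so q
  -- becomes nilpotent while coefficients up to N are read off directly.
  truncated : CommutativeRing 0ℓ 0ℓ
  truncated = record
    { Carrier = Series ; _≈_ = _≈ₙ_ ; _+_ = addS ; _*_ = mulS ; -_ = negS ; 0# = λ _ → + 0 ; 1# = one
    ; isCommutativeRing = record
      { isRing = record
        { +-isAbelianGroup = record
          { isGroup = record
            { isMonoid = record
              { isSemigroup = record
                { isMagma = record
                  { isEquivalence = record
                    { refl = pointwise λ _ _ → refl
                    ; sym = λ p → pointwise λ n l → sym (coefficient p n l)
                    ; trans = λ p q → pointwise λ n l → trans (coefficient p n l) (coefficient q n l) }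
                  ; ∙-cong = λ p q → pointwise λ n l → cong₂ ℤ._+_ (coefficient p n l) (coefficient q n l) }
                ; assoc = λ f g h → pointwise λ n _ → ℤₚ.+-assoc (f n) (g n) (h n) }
              ; identity = (λ f → pointwise λ n _ → ℤₚ.+-identityˡ (f n))
                         , (λ f → pointwise λ n _ → ℤₚ.+-identityʳ (f n)) }
            ; inverse = (λ f → pointwise λ n _ → ℤₚ.+-inverseˡ (f n))
                      , (λ f → pointwise λ n _ → ℤₚ.+-inverseʳ (f n))
            ; ⁻¹-cong = λ p → pointwise λ n l → cong ℤ.-_ (coefficient p n l) }
          ; comm = λ f g → pointwise λ n _ → ℤₚ.+-comm (f n) (g n) }
        ; *-cong = λ p q → pointwise λ n l →
            mulS-cong n (λ {k} k≤n → coefficient p k (ℕₚ.≤-trans k≤n l))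
                        (λ {k} k≤n → coefficient q k (ℕₚ.≤-trans k≤n l))
        ; *-assoc = λ f g h → pointwise λ n _ → mulS-assoc f g h n
        ; *-identity = (λ f → pointwise λ n _ → mulS-identityˡ f n)
                     , (λ f → pointwise λ n _ → trans (mulS-comm f one n) (mulS-identityˡ f n))
        ; distrib = (λ h f g → pointwise λ n _ → trans (mulS-comm h (addS f g) n)
                      (trans (mulS-distribʳ h f g n) (cong₂ ℤ._+_ (mulS-comm f h n) (mulS-comm g h n))))
                  , (λ h f g → pointwise λ n _ → mulS-distribʳ h f g n)
        }
      ; *-comm = λ f g → pointwise λ n _ → mulS-comm f g n } }

  scalarMorphism : ℤ.+-*-rawRing -Raw-AlmostCommutative⟶ fromCommutativeRing truncated
  scalarMorphism = record
    { ⟦_⟧    = scalar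
    ; +-homo = λ a b → pointwise λ { zero _ → refl ; (suc n) _ → refl }
    ; *-homo = λ a b → pointwise λ n _ → sym (trans (mulS-scalar a (scalar b) n) (scale a b n))
    ; -‿homo = λ a → pointwise λ { zero _ → refl ; (suc n) _ → refl }
    ; 0-homo = pointwise λ { zero _ → refl ; (suc n) _ → refl }
    ; 1-homo = pointwise λ n _ → sym (one≗scalar n)
    }
    where
    scale : ∀ a b n → a ℤ.* scalar b n ≡ scalar (a ℤ.* b) n
    scale a b zero    = refl
    scale a b (suc n) = ℤₚ.*-zeroʳ a

-- The defining factors as elements of the truncated ring

q : Series
q 1 = + 1
q _ = + 0

mulS-q : ∀ f n → mulS q f (suc n) ≡ f n
mulS-q f n = trans (mulS-suc q f n) (trans (ℤₚ.+-identityˡ _)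
  (trans (mulS-cong {g = f} n (λ {k} _ → tail-q k) (λ _ → refl)) (mulS-identityˡ f n)))
  where
  tail-q : ∀ k → tail q k ≡ one k
  tail-q zero    = refl
  tail-q (suc _) = refl

private
  split : ∀ k n → n ℕ.< k ⊎ ∃ λ n′ → n ≡ k ℕ.+ n′
  split k n with ℕₚ.<-≤-connex n k
  ... | inj₁ n<k = inj₁ n<k
  ... | inj₂ k≤n = inj₂ (n ℕ.∸ k , sym (ℕₚ.m+[n∸m]≡n k≤n))

  [k+n]%k : ∀ m n → (suc m ℕ.+ n) % suc m ≡ n % suc m
  [k+n]%k m n = trans (cong (_% suc m) (ℕₚ.+-comm (suc m) n)) ([m+n]%n≡m%n n (suc m))

  [k+n]/k : ∀ m n → (suc m ℕ.+ n) / suc m ≡ suc (n / suc m)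
  [k+n]/k m n = trans (m/n≡1+[m∸n]/n (ℕₚ.m≤m+n (suc m) n))
    (cong (λ t → suc (t / suc m)) (ℕₚ.m+n∸m≡n (suc m) n))

  alternating : ℕ → ℤ
  alternating a = if (a % 2) ℕ.≡ᵇ 0 then + 1 else ℤ.- + 1

  alternating-suc : ∀ a → alternating (suc a) ≡ ℤ.- alternating a
  alternating-suc 0 = refl
  alternating-suc 1 = refl
  alternating-suc (suc (suc a)) = alternating-suc a

invOneMinus-< : ∀ m {n} → n ℕ.< suc m → invOneMinus m n ≡ scalar (+ 1) n
invOneMinus-< m {zero}  _   = refl
invOneMinus-< m {suc n} n<m rewrite m<n⇒m%n≡m n<m = refl

invOneMinus-+ : ∀ m n → invOneMinus m (suc m ℕ.+ n) ≡ invOneMinus m n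
invOneMinus-+ m n = cong (λ r → if r ℕ.≡ᵇ 0 then + 1 else + 0) ([k+n]%k m n)

invOnePlus-< : ∀ m {n} → n ℕ.< suc m → invOnePlus m n ≡ scalar (+ 1) n
invOnePlus-< m {zero}  _   = refl
invOnePlus-< m {suc n} n<m rewrite m<n⇒m%n≡m n<m = refl

invOnePlus-+ : ∀ m n → invOnePlus m (suc m ℕ.+ n) ≡ ℤ.- invOnePlus m n
invOnePlus-+ m n = trans
  (cong₂ (λ r d → if r ℕ.≡ᵇ 0 then alternating d else + 0) ([k+n]%k m n) ([k+n]/k m n))
  (cases (n % suc m ℕ.≡ᵇ 0))
  where
  cases : ∀ b → (if b then alternating (suc (n / suc m)) else + 0)
              ≡ ℤ.- (if b then alternating (n / suc m) else + 0)
  cases true  = alternating-suc (n / suc m)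
  cases false = refl

module _ (N : ℕ) where
  private
    module R = CommutativeRing (truncated N)
    module T = Theta (truncated N) (scalarMorphism N)
  open R using (_≈_)
  open import Algebra.Properties.Semiring.Exp R.semiring using (_^_)

  q^-coefficient : ∀ k n → (q ^ k) n ≡ (if n ℕ.≡ᵇ k then + 1 else + 0)
  q^-coefficient zero    zero    = refl
  q^-coefficient zero    (suc n) = refl
  q^-coefficient (suc k) zero    = mulS-zero q (q ^ k)
  q^-coefficient (suc k) (suc n) = trans (mulS-q (q ^ k) n) (q^-coefficient k n)

  mulS-q^-< : ∀ k f {n} → n ℕ.< k → mulS (q ^ k) f n ≡ + 0
  mulS-q^-< (suc k) f {zero}  _         = trans (mulS-assoc q (q ^ k) f 0) (mulS-zero q (mulS (q ^ k) f))
  mulS-q^-< (suc k) f {suc n} (s≤s n<k) = trans (mulS-assoc q (q ^ k) f (suc n))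
    (trans (mulS-q (mulS (q ^ k) f) n) (mulS-q^-< k f n<k))

  mulS-q^-+ : ∀ k f n → mulS (q ^ k) f (k ℕ.+ n) ≡ f n
  mulS-q^-+ zero    f n = mulS-identityˡ f n
  mulS-q^-+ (suc k) f n = trans (mulS-assoc q (q ^ k) f (suc (k ℕ.+ n)))
    (trans (mulS-q (mulS (q ^ k) f) (k ℕ.+ n)) (mulS-q^-+ k f n))

  onePlus≗ : ∀ m n → onePlus m n ≡ addS T.𝟙 (q ^ suc m) n
  onePlus≗ m zero    = sym (cong (λ t → + 1 ℤ.+ t) (q^-coefficient (suc m) 0))
  onePlus≗ m (suc n) = sym (trans (ℤₚ.+-identityˡ _) (q^-coefficient (suc m) (suc n)))

  oneMinus≗ : ∀ m n → oneMinus m n ≡ addS T.𝟙 (negS (q ^ suc m)) n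
  oneMinus≗ m zero    = sym (cong (λ t → + 1 ℤ.+ ℤ.- t) (q^-coefficient (suc m) 0))
  oneMinus≗ m (suc n) = sym (trans (ℤₚ.+-identityˡ _)
    (trans (cong ℤ.-_ (q^-coefficient (suc m) (suc n))) (cases (n ℕ.≡ᵇ m))))
    where
    cases : ∀ b → ℤ.- (if b then + 1 else + 0) ≡ (if b then ℤ.- + 1 else + 0)
    cases true  = refl
    cases false = refl

  mulS-𝟙 : ∀ f n → mulS T.𝟙 f n ≡ f n
  mulS-𝟙 f n = trans (mulS-scalar (+ 1) f n) (ℤₚ.*-identityˡ (f n))

  -- Multiplication by q^(m+1) shifts by m + 1, and under this shift the coefficients of
  -- `invOnePlus m` change sign; everything cancels except the constant term.
  invOnePlus-inverse : ∀ m n → mulS (addS T.𝟙 (q ^ suc m)) (invOnePlus m) n ≡ T.𝟙 n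
  invOnePlus-inverse m n = trans (mulS-distribʳ (invOnePlus m) T.𝟙 (q ^ suc m) n)
    (trans (cong (ℤ._+ mulS (q ^ suc m) (invOnePlus m) n) (mulS-𝟙 (invOnePlus m) n)) (cases (split (suc m) n)))
    where
    cases : ∀ {n} → n ℕ.< suc m ⊎ (∃ λ n′ → n ≡ suc m ℕ.+ n′) →
      invOnePlus m n ℤ.+ mulS (q ^ suc m) (invOnePlus m) n ≡ scalar (+ 1) n
    cases (inj₁ n<k) = trans (cong₂ ℤ._+_ (invOnePlus-< m n<k) (mulS-q^-< (suc m) (invOnePlus m) n<k)) (ℤₚ.+-identityʳ _)
    cases (inj₂ (n′ , refl)) = trans (cong₂ ℤ._+_ (invOnePlus-+ m n′) (mulS-q^-+ (suc m) (invOnePlus m) n′))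
      (ℤₚ.+-inverseˡ (invOnePlus m n′))

  invOneMinus-inverse : ∀ m n → mulS (addS T.𝟙 (negS (q ^ suc m))) (invOneMinus m) n ≡ T.𝟙 n
  invOneMinus-inverse m n = trans (mulS-distribʳ (invOneMinus m) T.𝟙 (negS (q ^ suc m)) n)
    (trans (cong₂ ℤ._+_ (mulS-𝟙 (invOneMinus m) n) (mulS-negˡ (q ^ suc m) (invOneMinus m) n))
           (cases (split (suc m) n)))
    where
    cases : ∀ {n} → n ℕ.< suc m ⊎ (∃ λ n′ → n ≡ suc m ℕ.+ n′) →
      invOneMinus m n ℤ.+ ℤ.- mulS (q ^ suc m) (invOneMinus m) n ≡ scalar (+ 1) n
    cases (inj₁ n<k) = trans (cong₂ (λ a b → a ℤ.+ ℤ.- b) (invOneMinus-< m n<k) (mulS-q^-< (suc m) (invOneMinus m) n<k)) (ℤₚ.+-identityʳ _)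
    cases (inj₂ (n′ , refl)) = trans (cong₂ (λ a b → a ℤ.+ ℤ.- b) (invOneMinus-+ m n′) (mulS-q^-+ (suc m) (invOneMinus m) n′))
      (ℤₚ.+-inverseʳ (invOneMinus m n′))

  q-nilpotent : T.Nilpotent N q
  q-nilpotent = pointwise λ n n≤N →
    trans (sym (trans (mulS-comm (q ^ suc N) one n) (mulS-identityˡ (q ^ suc N) n))) (mulS-q^-< (suc N) one (s≤s n≤N))

  private
    a b : ℕ → Series
    a j = invOnePlus (18 ℕ.* j ℕ.+ 8)
    b j = invOneMinus (2 ℕ.* j)

    prodTo-suc : ∀ j → prodTo (suc j) ≈ mulS (mulS (mulS (addS T.𝟙 (q ^ suc (2 ℕ.* j)))
      (addS T.𝟙 (negS (q ^ suc (18 ℕ.* j ℕ.+ 8))))) (mulS (a j) (b j))) (prodTo j)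
    prodTo-suc j = pointwise λ n _ → mulS-cong {g = prodTo j} n (λ {k} _ → mulS-cong {g = mulS (a j) (b j)} k
      (λ {l} _ → mulS-cong l (λ {i} _ → onePlus≗ (2 ℕ.* j) i) (λ {i} _ → oneMinus≗ (18 ℕ.* j ℕ.+ 8) i))
      (λ _ → refl)) (λ _ → refl)

  prodTo-odd : ∀ J → T.Odd N (prodTo J)
  prodTo-odd = T.quotient-odd N {q} q-nilpotent a b prodTo
    (λ j → pointwise λ n _ → invOnePlus-inverse (18 ℕ.* j ℕ.+ 8) n) (λ j → pointwise λ n _ → invOneMinus-inverse (2 ℕ.* j) n)
    (pointwise λ n _ → one≗scalar n) prodTo-suc

  prodTo-oddProduct : ∀ J → mulS (prodTo J) (T.oddProduct N (q ^ 9) J) ≈ T.oddProduct N q J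
  prodTo-oddProduct = T.quotient-oddProduct N {q} q-nilpotent a b prodTo
    (λ j → pointwise λ n _ → invOnePlus-inverse (18 ℕ.* j ℕ.+ 8) n) (λ j → pointwise λ n _ → invOneMinus-inverse (2 ℕ.* j) n)
    (pointwise λ n _ → one≗scalar n) prodTo-suc

-- Supports of the dissected theta series

-- The disjunctive form lets supports be combined without deciding `P`, in particular for sums of
-- two squares.
SupportedIn : (ℕ → Set) → Series → Set
SupportedIn P f = ∀ n → f n ≡ + 0 ⊎ P n

module _ {P : ℕ → Set} where

  supp-⊆ : ∀ {Q : ℕ → Set} f → (∀ {n} → P n → Q n) → SupportedIn P f → SupportedIn Q f
  supp-⊆ f P⊆Q s n = [ inj₁ , inj₂ ∘ P⊆Q ]′ (s n)

  supp-+ : ∀ f g → SupportedIn P f → SupportedIn P g → SupportedIn P (addS f g)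
  supp-+ f g s t n with s n | t n
  ... | inj₂ p | _      = inj₂ p
  ... | inj₁ _ | inj₂ p = inj₂ p
  ... | inj₁ e | inj₁ e′ rewrite e | e′ = inj₁ refl

  supp-neg : ∀ f → SupportedIn P f → SupportedIn P (negS f)
  supp-neg f s n = [ (λ e → inj₁ (cong (λ z → ℤ.- z) e)) , inj₂ ]′ (s n)

  supp-scalar : ∀ z → P 0 → SupportedIn P (scalar z)
  supp-scalar z p zero    = inj₂ p
  supp-scalar z p (suc n) = inj₁ refl

  supp-∉ : ∀ f n → SupportedIn P f → ¬ P n → f n ≡ + 0
  supp-∉ f n s ¬p = [ id , ⊥-elim ∘ ¬p ]′ (s n)

supp-* : ∀ {P Q S : ℕ → Set} f g → (∀ {m n} → P m → Q n → S (m ℕ.+ n)) →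
  SupportedIn P f → SupportedIn Q g → SupportedIn S (mulS f g)
supp-* {P} {Q} {S} f g PQ⊆S s t n = go P S f PQ⊆S s n
  where
  term : ∀ (P S : ℕ → Set) f → (∀ {m n} → P m → Q n → S (m ℕ.+ n)) → SupportedIn P f →
    ∀ n → f 0 ℤ.* g n ≡ + 0 ⊎ S n
  term P S f PQ⊆S s n with s 0 | t n
  ... | inj₁ e | _      rewrite e = inj₁ refl
  ... | inj₂ _ | inj₁ e rewrite e = inj₁ (ℤₚ.*-zeroʳ (f 0))
  ... | inj₂ p | inj₂ q = inj₂ (PQ⊆S p q)
  -- `P` and `S` are generalised because passing to `tail f` shifts both by one while the support of
  -- g stays fixed.
  go : ∀ (P S : ℕ → Set) f → (∀ {m n} → P m → Q n → S (m ℕ.+ n)) → SupportedIn P f → SupportedIn S (mulS f g)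
  go P S f PQ⊆S s zero rewrite mulS-zero f g = term P S f PQ⊆S s 0
  go P S f PQ⊆S s (suc n) rewrite mulS-suc f g n
    with term P S f PQ⊆S s (suc n) | go (P ∘ suc) (S ∘ suc) (tail f) PQ⊆S (s ∘ suc) n
  ... | inj₂ p | _      = inj₂ p
  ... | inj₁ _ | inj₂ p = inj₂ p
  ... | inj₁ e | inj₁ e′ rewrite e | e′ = inj₁ refl

supp-scale : ∀ {P} f g → SupportedIn (_≡ 0) f → SupportedIn P g → SupportedIn P (mulS f g)
supp-scale {P} f g = supp-* {_≡ 0} {P} {P} f g λ { refl p → p }

supp-q : SupportedIn (_≡ 1) q
supp-q 0             = inj₁ refl
supp-q 1             = inj₂ refl
supp-q (suc (suc _)) = inj₁ refl

supp-one : SupportedIn (_≡ 0) one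
supp-one zero    = inj₂ refl
supp-one (suc _) = inj₁ refl

module Residues (d : ℕ) .{{_ : ℕ.NonZero d}} where

  +%-cong : ∀ {m n r s} → m % d ≡ r → n % d ≡ s → (m ℕ.+ n) % d ≡ (r ℕ.+ s) % d
  +%-cong {m} {n} e e′ = trans (%-distribˡ-+ m n d) (cong₂ (λ a b → (a ℕ.+ b) % d) e e′)

  *%-cong : ∀ {m n r s} → m % d ≡ r → n % d ≡ s → (m ℕ.* n) % d ≡ (r ℕ.* s) % d
  *%-cong {m} {n} e e′ = trans (%-distribˡ-* m n d) (cong₂ (λ a b → (a ℕ.* b) % d) e e′)

  *-zero% : ∀ m k → k % d ≡ 0 → (m ℕ.* k) % d ≡ 0
  *-zero% m k e = trans (*%-cong {m} refl e) (trans (cong (_% d) (ℕₚ.*-zeroʳ (m % d))) (m*n%n≡0 0 d))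

  +-multiple% : ∀ c t e → (c ℕ.+ t ℕ.* (e ℕ.* d)) % d ≡ c % d
  +-multiple% c t e = trans (cong (λ x → (c ℕ.+ x) % d) (sym (ℕₚ.*-assoc t e d))) ([m+kn]%n≡m%n c (t ℕ.* e) d)

  class : ℕ → ℕ → Set
  class r n = n % d ≡ r

  class-* : ∀ {r s} f g → SupportedIn (class r) f → SupportedIn (class s) g →
    SupportedIn (class ((r ℕ.+ s) % d)) (mulS f g)
  class-* f g = supp-* f g (λ {m} {n} → +%-cong {m} {n})

module %2 = Residues 2
module %3 = Residues 3

Even : ℕ → Set
Even n = n % 2 ≡ 0

≢1%3 ≢2%3 : ℕ → Set
≢1%3 n = n % 3 ≡ 0 ⊎ n % 3 ≡ 2
≢2%3 n = n % 3 ≡ 0 ⊎ n % 3 ≡ 1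

module _ (N L : ℕ) where
  private
    module R = CommutativeRing (truncated N)
    module T = Theta (truncated N) (scalarMorphism N)
  open import Algebra.Properties.Semiring.Exp R.semiring using (_^_)
  open T.QuotientExpansion q L

  supp-^ : ∀ {a} f → SupportedIn (_≡ a) f → ∀ n → SupportedIn (_≡ n ℕ.* a) (f ^ n)
  supp-^ f s zero    = supp-one
  supp-^ f s (suc n) = supp-* f (f ^ n) (λ { refl refl → refl }) s (supp-^ f s n)

  supp-square-^ : ∀ k s → SupportedIn (_≡ s ℕ.* s ℕ.* k) (T.square-^ (q ^ k) s)
  supp-square-^ k s = supp-⊆ (T.square-^ (q ^ k) s)
    (λ { refl → cong (s ℕ.* s ℕ.*_) (ℕₚ.*-identityʳ k) })
    (supp-^ (q ^ k) (supp-^ q supp-q k) (s ℕ.* s))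

  supp-square-q : ∀ s → SupportedIn (_≡ s ℕ.* s) (T.square-^ q s)
  supp-square-q s = supp-⊆ (T.square-^ q s) (λ { refl → ℕₚ.*-identityʳ (s ℕ.* s) }) (supp-^ q supp-q (s ℕ.* s))

  supp-sign : ∀ s → SupportedIn (_≡ 0) (T.sign s)
  supp-sign zero    = supp-scalar (+ 1) refl
  supp-sign (suc s) = supp-neg (T.sign s) (supp-sign s)

  module _ {P : ℕ → Set} where

    supp-∑ : ∀ f → (∀ t → SupportedIn P (f t)) → ∀ n → SupportedIn P (T.∑ n f)
    supp-∑ f s zero    zero    = inj₁ refl
    supp-∑ f s zero    (suc _) = inj₁ refl
    supp-∑ f s (suc n) = supp-+ (T.∑ n f) (f n) (supp-∑ f s n) (s n)

    supp-scalar-* : ∀ z f → SupportedIn P f → SupportedIn P (mulS (scalar z) f)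
    supp-scalar-* z f = supp-scale (scalar z) f (supp-scalar z refl)

    square-term : ∀ s → P (s ℕ.* s) → SupportedIn P (T.square-^ q s)
    square-term s p = supp-⊆ (T.square-^ q s) (λ { refl → p }) (supp-square-q s)

    power-term : ∀ k s → P (s ℕ.* s ℕ.* k) → SupportedIn P (T.square-^ (q ^ k) s)
    power-term k s p = supp-⊆ (T.square-^ (q ^ k) s) (λ { refl → p }) (supp-square-^ k s)

    sign-power-term : ∀ k s → P (s ℕ.* s ℕ.* k) → SupportedIn P (mulS (T.sign s) (T.square-^ (q ^ k) s))
    sign-power-term k s p = supp-scale (T.sign s) (T.square-^ (q ^ k) s) (supp-sign s) (power-term k s p)

  private
    c d h : Series
    c = T.half-θ-neg (q ^ 2) L
    d = T.half-θ-neg (q ^ 18) L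
    h = T.half-θ (q ^ 36) L

    sixfold₂ : ∀ c t → ((c ℕ.+ t ℕ.* 6) ℕ.* (c ℕ.+ t ℕ.* 6)) % 2 ≡ (c % 2 ℕ.* (c % 2)) % 2
    sixfold₂ c t = %2.*%-cong {c ℕ.+ t ℕ.* 6} {c ℕ.+ t ℕ.* 6} (%2.+-multiple% c t 3) (%2.+-multiple% c t 3)

    sixfold₃ : ∀ c t → ((c ℕ.+ t ℕ.* 6) ℕ.* (c ℕ.+ t ℕ.* 6)) % 3 ≡ (c % 3 ℕ.* (c % 3)) % 3
    sixfold₃ c t = %3.*%-cong {c ℕ.+ t ℕ.* 6} {c ℕ.+ t ℕ.* 6} (%3.+-multiple% c t 2) (%3.+-multiple% c t 2)

    threefold₃ : ∀ c t → ((c ℕ.+ t ℕ.* 3) ℕ.* (c ℕ.+ t ℕ.* 3) ℕ.* 4) % 3 ≡ ((c % 3 ℕ.* (c % 3)) % 3 ℕ.* 1) % 3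
    threefold₃ c t = %3.*%-cong {(c ℕ.+ t ℕ.* 3) ℕ.* (c ℕ.+ t ℕ.* 3)} {4}
      (%3.*%-cong {c ℕ.+ t ℕ.* 3} {c ℕ.+ t ℕ.* 3} (%3.+-multiple% c t 1) (%3.+-multiple% c t 1)) refl

    -- Squares are 0 or 1 modulo 3. This keeps the exponents of θ(-q²) out of the class 1.
    double-square : ∀ s → ≢1%3 (s ℕ.* s ℕ.* 2)
    double-square s = residue (s % 3) refl (m%n<n s 3)
      where
      value : ∀ {r} → s % 3 ≡ r → (s ℕ.* s ℕ.* 2) % 3 ≡ ((r ℕ.* r) % 3 ℕ.* 2) % 3
      value e = %3.*%-cong {s ℕ.* s} {2} (%3.*%-cong {s} {s} e e) refl
      residue : ∀ r → s % 3 ≡ r → r ℕ.< 3 → ≢1%3 (s ℕ.* s ℕ.* 2)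
      residue 0 e _ = inj₁ (value e)
      residue 1 e _ = inj₂ (value e)
      residue 2 e _ = inj₂ (value e)
      residue (suc (suc (suc _))) _ (s≤s (s≤s (s≤s ())))

    module _ {P : ℕ → Set} where

      β-in : (∀ c t → c ≡ 1 ⊎ c ≡ 5 → P ((c ℕ.+ t ℕ.* 6) ℕ.* (c ℕ.+ t ℕ.* 6))) → SupportedIn P β
      β-in p = supp-∑ _ (λ t → supp-+ (T.square-^ q (1 ℕ.+ t ℕ.* 6)) (T.square-^ q (5 ℕ.+ t ℕ.* 6))
        (square-term (1 ℕ.+ t ℕ.* 6) (p 1 t (inj₁ refl))) (square-term (5 ℕ.+ t ℕ.* 6) (p 5 t (inj₂ refl)))) L

      δ-in : (∀ c t → c ≡ 2 ⊎ c ≡ 4 → P ((c ℕ.+ t ℕ.* 6) ℕ.* (c ℕ.+ t ℕ.* 6))) → SupportedIn P δ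
      δ-in p = supp-∑ _ (λ t → supp-+ (T.square-^ q (2 ℕ.+ t ℕ.* 6)) (T.square-^ q (4 ℕ.+ t ℕ.* 6))
        (square-term (2 ℕ.+ t ℕ.* 6) (p 2 t (inj₁ refl))) (square-term (4 ℕ.+ t ℕ.* 6) (p 4 t (inj₂ refl)))) L

      γ-in : (∀ t → P ((3 ℕ.+ t ℕ.* 6) ℕ.* (3 ℕ.+ t ℕ.* 6))) → SupportedIn P γ
      γ-in p = supp-∑ _ (λ t → square-term (3 ℕ.+ t ℕ.* 6) (p t)) L

      ε-in : (∀ t → P ((6 ℕ.+ t ℕ.* 6) ℕ.* (6 ℕ.+ t ℕ.* 6))) → SupportedIn P ε
      ε-in p = supp-∑ _ (λ t → square-term (6 ℕ.+ t ℕ.* 6) (p t)) L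

      g₁-in : (∀ c t → c ≡ 1 ⊎ c ≡ 2 → P ((c ℕ.+ t ℕ.* 3) ℕ.* (c ℕ.+ t ℕ.* 3) ℕ.* 4)) → SupportedIn P g₁
      g₁-in p = supp-∑ _ (λ t → supp-+ (term (1 ℕ.+ t ℕ.* 3)) (term (2 ℕ.+ t ℕ.* 3))
        (sign-power-term 4 (1 ℕ.+ t ℕ.* 3) (p 1 t (inj₁ refl))) (sign-power-term 4 (2 ℕ.+ t ℕ.* 3) (p 2 t (inj₂ refl)))) L
        where
        term : ℕ → Series
        term s = mulS (T.sign s) (T.square-^ (q ^ 4) s)

      g₀-in : (∀ t → P ((3 ℕ.+ t ℕ.* 3) ℕ.* (3 ℕ.+ t ℕ.* 3) ℕ.* 4)) → SupportedIn P g₀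
      g₀-in p = supp-∑ _ (λ t → sign-power-term 4 (3 ℕ.+ t ℕ.* 3) (p t)) L

      half-θ-neg-in : ∀ k → (∀ s → P (s ℕ.* s ℕ.* k)) → SupportedIn P (T.half-θ-neg (q ^ k) L)
      half-θ-neg-in k p = supp-∑ _ (λ s → power-term k (suc s) (p (suc s))) L

      half-θ-in : ∀ k → (∀ s → P (s ℕ.* s ℕ.* k)) → SupportedIn P (T.half-θ (q ^ k) L)
      half-θ-in k p = supp-∑ _ (λ s → sign-power-term k (suc s) (p (suc s))) L

    even-* : ∀ f g → SupportedIn Even f → SupportedIn Even g → SupportedIn Even (mulS f g)
    even-* = %2.class-*

    1+2-in : ∀ {P : ℕ → Set} f → P 0 → SupportedIn P f → SupportedIn P (addS T.𝟙 (mulS T.𝟚 f))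
    1+2-in f p s = supp-+ T.𝟙 (mulS T.𝟚 f) (supp-scalar (+ 1) p) (supp-scalar-* (+ 2) f s)

    module Parity where
      β-odd : SupportedIn (%2.class 1) β
      β-odd = β-in λ { _ t (inj₁ refl) → sixfold₂ 1 t ; _ t (inj₂ refl) → sixfold₂ 5 t }
      γ-odd : SupportedIn (%2.class 1) γ
      γ-odd = γ-in (sixfold₂ 3)
      δ-even : SupportedIn Even δ
      δ-even = δ-in λ { _ t (inj₁ refl) → sixfold₂ 2 t ; _ t (inj₂ refl) → sixfold₂ 4 t }
      A-even : SupportedIn Even A
      A-even = 1+2-in ε refl (ε-in (sixfold₂ 6))
      g-even : SupportedIn Even g
      g-even = supp-+ g₁ g₀ (g₁-in λ c t _ → %2.*-zero% ((c ℕ.+ t ℕ.* 3) ℕ.* (c ℕ.+ t ℕ.* 3)) 4 refl)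
                            (g₀-in λ t → %2.*-zero% ((3 ℕ.+ t ℕ.* 3) ℕ.* (3 ℕ.+ t ℕ.* 3)) 4 refl)
      c-even : SupportedIn Even c
      c-even = half-θ-neg-in 2 λ s → %2.*-zero% (s ℕ.* s) 2 refl
      d-even : SupportedIn Even d
      d-even = half-θ-neg-in 18 λ s → %2.*-zero% (s ℕ.* s) 18 refl
      h-even : SupportedIn Even h
      h-even = half-θ-in 36 λ s → %2.*-zero% (s ℕ.* s) 36 refl
      k-even : SupportedIn Even k
      k-even = supp-+ (addS c d) (mulS T.𝟚 (mulS c d)) (supp-+ c d c-even d-even)
        (supp-scalar-* (+ 2) (mulS c d) (even-* c d c-even d-even))
      -- The odd series β and γ enter only through the products βγ and γ².
      E-even : SupportedIn Even E
      E-even = supp-+ (addS (mulS A A) (mulS T.𝟚 (mulS δ A))) _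
        (supp-+ (mulS A A) (mulS T.𝟚 (mulS δ A)) (even-* A A A-even A-even)
          (supp-scalar-* (+ 2) (mulS δ A) (even-* δ A δ-even A-even)))
        (supp-neg _ (supp-scalar-* (+ 4) (addS (mulS β γ) (mulS γ γ))
          (supp-+ (mulS β γ) (mulS γ γ) (%2.class-* β γ β-odd γ-odd) (%2.class-* γ γ γ-odd γ-odd))))
      square-even : ∀ f → SupportedIn Even f → SupportedIn Even (mulS f f)
      square-even f s = even-* f f s s
      𝓔-even : SupportedIn Even 𝓔
      𝓔-even = even-* E (mulS (mulS (addS T.𝟙 (mulS T.𝟚 k)) (mulS 1+2g 1+2g)) T²) E-even
        (even-* (mulS (addS T.𝟙 (mulS T.𝟚 k)) (mulS 1+2g 1+2g)) T²
          (even-* (addS T.𝟙 (mulS T.𝟚 k)) (mulS 1+2g 1+2g) (1+2-in k refl k-even)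
            (square-even 1+2g (1+2-in g refl g-even)))
          (square-even (addS T.𝟙 (mulS T.𝟚 h)) (1+2-in h refl h-even)))
        where
        1+2g : Series
        1+2g = addS T.𝟙 (mulS T.𝟚 g)
      z-even : SupportedIn Even z
      z-even = supp-+ (addS g (mulS g g)) (addS h (mulS h h))
        (supp-+ g (mulS g g) g-even (square-even g g-even)) (supp-+ h (mulS h h) h-even (square-even h h-even))

    module Mod3 where
      β-1 : SupportedIn (%3.class 1) β
      β-1 = β-in λ { _ t (inj₁ refl) → sixfold₃ 1 t ; _ t (inj₂ refl) → sixfold₃ 5 t }
      δ-1 : SupportedIn (%3.class 1) δ
      δ-1 = δ-in λ { _ t (inj₁ refl) → sixfold₃ 2 t ; _ t (inj₂ refl) → sixfold₃ 4 t }
      γ-0 : SupportedIn (%3.class 0) γ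
      γ-0 = γ-in (sixfold₃ 3)
      A-0 : SupportedIn (%3.class 0) A
      A-0 = 1+2-in ε refl (ε-in (sixfold₃ 6))
      O-1 : SupportedIn (%3.class 1) O
      O-1 = supp-+ (mulS β A) _ (%3.class-* β A β-1 A-0)
        (supp-neg _ (supp-scalar-* (+ 2) (mulS δ γ) (%3.class-* δ γ δ-1 γ-0)))
      g₁-1 : SupportedIn (%3.class 1) g₁
      g₁-1 = g₁-in λ { _ t (inj₁ refl) → threefold₃ 1 t ; _ t (inj₂ refl) → threefold₃ 2 t }
      g₀-0 : SupportedIn (%3.class 0) g₀
      g₀-0 = g₀-in (threefold₃ 3)
      T²-0 : SupportedIn (%3.class 0) T²
      T²-0 = %3.class-* 1+2h 1+2h 1+2h-0 1+2h-0
        where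
        1+2h : Series
        1+2h = addS T.𝟙 (mulS T.𝟚 h)
        1+2h-0 : SupportedIn (%3.class 0) 1+2h
        1+2h-0 = 1+2-in h refl (half-θ-in 36 λ s → %3.*-zero% (s ℕ.* s) 36 refl)
      ≢1-* : ∀ f g → SupportedIn ≢1%3 f → SupportedIn (%3.class 0) g → SupportedIn ≢1%3 (mulS f g)
      ≢1-* f g = supp-* f g λ { {m} {n} (inj₁ e) e′ → inj₁ (%3.+%-cong {m} {n} e e′)
                              ; {m} {n} (inj₂ e) e′ → inj₂ (%3.+%-cong {m} {n} e e′) }
      0-≢1 : ∀ f → SupportedIn (%3.class 0) f → SupportedIn ≢1%3 f
      0-≢1 f = supp-⊆ f inj₁
      c-≢1 : SupportedIn ≢1%3 c
      c-≢1 = half-θ-neg-in 2 double-square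
      d-0 : SupportedIn (%3.class 0) d
      d-0 = half-θ-neg-in 18 λ s → %3.*-zero% (s ℕ.* s) 18 refl
      k-≢1 : SupportedIn ≢1%3 k
      k-≢1 = supp-+ (addS c d) (mulS T.𝟚 (mulS c d)) (supp-+ c d c-≢1 (0-≢1 d d-0))
        (supp-scalar-* (+ 2) (mulS c d) (≢1-* c d c-≢1 d-0))
      -- g₁ occurs only as g₁², with exponents 1 + 1 = 2, and k is multiplied only by series in q³.
      W-≢1 : SupportedIn ≢1%3 W
      W-≢1 = supp-+ (addS T.𝟙 (mulS (scalar (+ 4)) sum)) (mulS T.𝟚 (mulS k 1+4G))
        (supp-+ T.𝟙 (mulS (scalar (+ 4)) sum) (supp-scalar (+ 1) (inj₁ refl)) (supp-scalar-* (+ 4) sum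
          (supp-+ G (mulS g₁ g₁) (0-≢1 G G-0) (supp-⊆ (mulS g₁ g₁) inj₂ (%3.class-* g₁ g₁ g₁-1 g₁-1)))))
        (supp-scalar-* (+ 2) (mulS k 1+4G) (≢1-* k 1+4G k-≢1
          (supp-+ T.𝟙 (mulS (scalar (+ 4)) G) (supp-scalar (+ 1) refl) (supp-scalar-* (+ 4) G G-0))))
        where
        G sum 1+4G : Series
        G = addS g₀ (mulS g₀ g₀)
        sum = addS G (mulS g₁ g₁)
        1+4G = addS T.𝟙 (mulS (scalar (+ 4)) G)
        G-0 : SupportedIn (%3.class 0) G
        G-0 = supp-+ g₀ (mulS g₀ g₀) g₀-0 (%3.class-* g₀ g₀ g₀-0 g₀-0)
      -- Adding 1 from `O` to 0 or 2 from `W` gives 1 or 0 modulo 3, and `T²` adds 0.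
      OWT²-≢2 : SupportedIn ≢2%3 (mulS (mulS O W) T²)
      OWT²-≢2 = supp-* {≢2%3} {%3.class 0} {≢2%3} (mulS O W) T²
        (λ { {m} {n} (inj₁ e) e′ → inj₁ (%3.+%-cong {m} {n} e e′)
           ; {m} {n} (inj₂ e) e′ → inj₂ (%3.+%-cong {m} {n} e e′) })
        (supp-* {%3.class 1} {≢1%3} {≢2%3} O W (λ { {m} {n} e (inj₁ e′) → inj₂ (%3.+%-cong {m} {n} e e′)
                       ; {m} {n} e (inj₂ e′) → inj₁ (%3.+%-cong {m} {n} e e′) }) O-1 W-≢1) T²-0

    -- β contributes x² and g₁ contributes 4s² = (2s)².
    βg₁-sumOfTwoSquares : SupportedIn SumOfTwoSquares (mulS β g₁)
    βg₁-sumOfTwoSquares = supp-* {λ n → ∃ λ s → n ≡ s ℕ.* s} {λ n → ∃ λ s → n ≡ s ℕ.* s} β g₁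
      (λ { (x , refl) (y , refl) → x , y , refl })
      (β-in λ c t _ → c ℕ.+ t ℕ.* 6 , refl)
      (g₁-in λ c t _ → (c ℕ.+ t ℕ.* 3) ℕ.* 2 , Arithmetic.quadruple-square (c ℕ.+ t ℕ.* 3))

  expandedQuotient : Series → Series
  expandedQuotient κ = addS (addS (addS (addS 𝓔 (mulS T.𝟚 (mulS (mulS O W) T²))) (mulS (scalar (+ 8)) (mulS β g₁)))
               (negS (mulS (scalar (+ 8)) z))) (mulS (scalar (+ 16)) κ)

  -- `𝓔` and `z` vanish at n by parity, `O * W * T²` by the residue modulo 3, and β g₁ because n is
  -- not a sum of two squares.
  expandedQuotient-coefficient : ∀ κ {n} → n % 2 ≡ 1 → n % 3 ≡ 2 → ¬ SumOfTwoSquares n → expandedQuotient κ n ≡ + 16 ℤ.* κ n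
  expandedQuotient-coefficient κ {n} n%2 n%3 ¬squares = trans (cong₂ ℤ._+_
    (cong₂ ℤ._+_ (cong₂ ℤ._+_ (cong₂ ℤ._+_
      (supp-∉ 𝓔 n Parity.𝓔-even not-even)
      (supp-∉ (mulS T.𝟚 (mulS (mulS O W) T²)) n (supp-scalar-* (+ 2) (mulS (mulS O W) T²) Mod3.OWT²-≢2) not-≢2))
      (supp-∉ (mulS (scalar (+ 8)) (mulS β g₁)) n (supp-scalar-* (+ 8) (mulS β g₁) βg₁-sumOfTwoSquares) ¬squares))
      (supp-∉ (negS (mulS (scalar (+ 8)) z)) n (supp-neg (mulS (scalar (+ 8)) z) (supp-scalar-* (+ 8) z Parity.z-even)) not-even))
    (mulS-scalar (+ 16) κ n)) (ℤₚ.+-identityˡ (+ 16 ℤ.* κ n))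
    where
    not-even : ¬ Even n
    not-even e with () ← trans (sym n%2) e
    not-≢2 : ¬ ≢2%3 n
    not-≢2 (inj₁ e) with () ← trans (sym n%3) e
    not-≢2 (inj₂ e) with () ← trans (sym n%3) e

-- The congruence for a single coefficient

powS≡^ : ∀ N r f n → powS r f n ≡ Algebra.Properties.Semiring.Exp._^_ (CommutativeRing.semiring (truncated N)) f r n
powS≡^ N zero    f n = refl
powS≡^ N (suc r) f n = mulS-cong {f} n (λ _ → refl) (λ {k} _ → powS≡^ N r f k)

open import Data.Integer.Divisibility using (_∣_)

16∣S9bar : ∀ m {N} → N % 2 ≡ 1 → N % 3 ≡ 2 → ¬ SumOfTwoSquares N → (+ 16) ∣ S9bar (8 ℕ.* m ℕ.+ 1) N
16∣S9bar m {N} N%2 N%3 ¬squares = Signed.∣⇒∣ᵤ (Signed.divides (κ N ℤ.+ μ N) (begin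
  powS (8 ℕ.* m ℕ.+ 1) F N           ≡⟨ powS≡^ N (8 ℕ.* m ℕ.+ 1) F N ⟩
  (F ^ (8 ℕ.* m ℕ.+ 1)) N            ≡⟨ coefficient (proj₂ power) N ℕₚ.≤-refl ⟩
  F N ℤ.+ mulS (scalar (+ 16)) μ N   ≡⟨ cong₂ ℤ._+_ F-coefficient (mulS-scalar (+ 16) μ N) ⟩
  + 16 ℤ.* κ N ℤ.+ + 16 ℤ.* μ N      ≡⟨ ℤₚ.*-distribˡ-+ (+ 16) (κ N) (μ N) ⟨
  + 16 ℤ.* (κ N ℤ.+ μ N)             ≡⟨ ℤₚ.*-comm (+ 16) (κ N ℤ.+ μ N) ⟩
  (κ N ℤ.+ μ N) ℤ.* + 16             ∎))
  where
  open ≡.≡-Reasoning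
  module T = Theta (truncated N) (scalarMorphism N)
  open import Algebra.Properties.Semiring.Exp (CommutativeRing.semiring (truncated N)) using (_^_)
  F : Series
  F = prodTo (suc N)
  odd : T.Odd N F
  odd = prodTo-odd N (suc N)
  power = T.power-8m+1 {F} {proj₁ odd} (proj₂ odd) m
  -- The truncation order M is N itself; J = N + 1 is the number of factors in the definition of
  -- `S9bar`, and L = N + 1 blocks are enough because L ≥ M.
  expansion = T.QuotientExpansion.quotient-expansion q (suc N) {N} {F} {proj₁ odd} {suc N}
    (q-nilpotent N) (ℕₚ.n≤1+n N) (ℕₚ.n≤1+n N) (prodTo-oddProduct N (suc N)) (proj₂ odd)
  μ κ : Series
  μ = proj₁ power
  κ = proj₁ expansion
  F-coefficient : F N ≡ + 16 ℤ.* κ N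
  F-coefficient = trans (coefficient (proj₂ expansion) N ℕₚ.≤-refl)
    (expandedQuotient-coefficient N (suc N) κ N%2 N%3 ¬squares)

open import Data.Nat using (_+_; _*_; _^_; _≤_; _∸_)
open import Data.Integer using (-_)

theorem3p8 : (p : ℕ) → Prime p → 5 ≤ p → LegendreMinusOne (- (+ 9)) p →
    (m α n i : ℕ) → 1 ≤ i → i ≤ p ∸ 1 →
    (+ 16) ∣ S9bar (8 * m + 1) (12 * p ^ (2 * α + 2) * n + (12 * i + 5 * p) * p ^ (2 * α + 1))
theorem3p8 p pp 5≤p legendre m α n i 1≤i i≤p-1 = 16∣S9bar m
  (index% p α n i 2 6 refl (square%2 pp 5≤p))
  (index% p α n i 3 4 refl (square%3 pp 5≤p))
  λ squares → odd-valuation⇒¬sumOfTwoSquares pp legendre α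
    (index-cofactor pp 5≤p n 1≤i i≤p-1)
    (subst SumOfTwoSquares (index-factored p α n i) squares)
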